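{- Let $m,n\ge1$, let $b\in\mathbb R^m$ be such that $P(b)$ is non-empty, and set $\Gamma=\Gamma(\mathcal L^n,b)$. Let $F:\mathcal L^n\to\mathbb R$ be the European function defined by $\ell$-positive vectors $u_1,\dots,u_r$ with $u_j=u_j^+$ and numbers $s_1,\dots,s_r,C\ge0$, i.e. $$F(\lambda_1\cdots\lambda_n)=\Big(\sum_{j=1}^r s_j\,u_j(\lambda_1)\cdots u_j(\lambda_n)-C\Big)^+ .$$ Put $\beta(0)=1$ and $\beta(i)=\frac{1+b(i)}2$ for $1\le i\le m$, and for $1\le j\le r$ put $\alpha_j(0)=u_j(\nu_0)$ and $\alpha_j(i)=u_j(\nu_i)-u_j(\nu_0)$ for $1\le i\le m$. Then $$F_{\min}(\Gamma)\ \ge\ \sum_{k_0+\dots+k_m=n}\frac{n!}{k_0!\cdots k_m!}\,\beta(0)^{k_0}\cdots\beta(m)^{k_m}\Big(\sum_{j=1}^r s_j\,\alpha_j(0)^{k_0}\cdots\alpha_j(m)^{k_m}-C\Big)^+ ,$$ where the sum runs over tuples of non-negative integers with sum $n$.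
   Context: Fix an integer $m\ge1$. $\mathcal L$ is the set of all functions $\lambda:\{1,\dots,m\}\to\{0,1\}$, with the convention $\lambda(0)=0$. $\mathbb R^{\mathcal L}$ is the space of functions $\mathcal L\to\mathbb R$ with standard inner product $\langle\ ,\ \rangle$. For $0\le i\le m$ let $\ell_i(\lambda)=(-1)^{\lambda(i)}$ (so $\ell_0$ is constant $1$). For $b\in\mathbb R^m$, $P(b)=\{x\in\mathbb R^{\mathcal L}: x(\lambda)\ge 0\ \forall\lambda,\ \langle \ell_0,x\rangle=1,\ \langle \ell_i,x\rangle=b(i)\text{ for }1\le i\le m\}$, a set of probability density functions on $\mathcal L$. A vector $\sum_{i=0}^m a_i\ell_i$ is $\ell$-positive if $a_1,\dots,a_m>0$ ($a_0\in\mathbb R$ arbitrary). For $t\in\mathbb R$, $t^+=\max\{t,0\}$, and $v^+(\lambda)=v(\lambda)^+$ for $v\in\mathbb R^{\mathcal L}$. Elements of $\mathcal L^n$ are regarded as words of length $n$. Let $\mathcal T^*$ be the set of words of length $<n$ in the alphabet $\mathcal L$. For $\Phi:\mathcal T^*\to P(b)$ let $P(\Phi)$ be the probability density on $\mathcal L^n$ given by $P(\Phi)(\lambda_1\cdots\lambda_n)=\prod_{k=1}^n\Phi(\lambda_1\cdots\lambda_{k-1})(\lambda_k)$, and $\Gamma(\mathcal L^n,b)=\{P(\Phi):\Phi:\mathcal T^*\to P(b)\}$. $F_{\min}(\Gamma)$ is the minimum of the expectation $E_P(F)$ over $P\in\Gamma$. $\nu_i\in\mathcal L$ ($0\le i\le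 m$) is $\nu_i(j)=1-\delta_{ij}$ for $1\le j\le m$ (so $\nu_0$ is constant $1$). Convention: $0^0=1$. -}

module Defs where

open import Level using (Level; _⊔_) renaming (suc to lsuc)
open import Algebra.Bundles using (CommutativeRing; Semiring)
open import Algebra.Structures using (IsCommutativeRing)
import Algebra.Construct.NaturalChoice.Max as Max
import Algebra.Definitions.RawSemiring as RawSemiringDefs
open import Data.Bool.Base using (if_then_else_)
open import Data.Fin.Base using (Fin; zero; suc; toℕ)
import Data.Fin.Properties as Fin
open import Data.List.Base as List using (List; []; _∷_; allFin; upTo; cartesianProductWith)
open import Data.Nat.Base as ℕ using (ℕ; zero; suc; _!; NonZero)
import Data.Nat.Properties as ℕ
open import Data.Product.Base using (∃; ∃-syntax; Σ-syntax; _×_; _,_; proj₁)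
open import Data.Vec.Base as Vec using (Vec; []; _∷_; lookup; tabulate; truncate)
open import Relation.Binary.Bundles using (DecTotalOrder)
open import Relation.Binary.Core using (Rel)
import Relation.Binary.Construct.NonStrictToStrict as ToStrict
open import Relation.Binary.Structures using (IsDecTotalOrder)
open import Relation.Nullary using (¬_; does)
open import Relation.Unary using (Pred)

-- The real numbers, axiomatised as a Dedekind-complete ordered field; as in
-- classical analysis, the order is total and decidable.  The value of the
-- inverse at zero is unspecified and never used.
record CompleteOrderedField (c ℓ₁ ℓ₂ : Level) : Set (lsuc (c ⊔ ℓ₁ ⊔ ℓ₂)) where
  infix  8 -_
  infix  9 _⁻¹
  infixl 7 _*_
  infixl 6 _+_
  infix  4 _≈_ _≤_
  field
    Carrier           : Set c
    _≈_               : Rel Carrier ℓ₁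
    _≤_               : Rel Carrier ℓ₂
    _+_ _*_           : Carrier → Carrier → Carrier
    -_ _⁻¹            : Carrier → Carrier
    0# 1#             : Carrier
    isCommutativeRing : IsCommutativeRing _≈_ _+_ _*_ -_ 0# 1#
    0≉1               : ¬ (0# ≈ 1#)
    *-inverseʳ        : ∀ x → ¬ (x ≈ 0#) → x * x ⁻¹ ≈ 1#
    isDecTotalOrder   : IsDecTotalOrder _≈_ _≤_
    +-monoˡ-≤         : ∀ z {x y} → x ≤ y → x + z ≤ y + z
    *-nonNeg          : ∀ {x y} → 0# ≤ x → 0# ≤ y → 0# ≤ x * y

  IsUpperBound : ∀ {ℓ} → Pred Carrier ℓ → Pred Carrier (c ⊔ ℓ₂ ⊔ ℓ)
  IsUpperBound S t = ∀ x → S x → x ≤ t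

  field
    supremum : (S : Pred Carrier (c ⊔ ℓ₁ ⊔ ℓ₂)) →
               ∃ S → ∃ (IsUpperBound S) →
               ∃[ s ] IsUpperBound S s × (∀ t → IsUpperBound S t → s ≤ t)

  commutativeRing : CommutativeRing c ℓ₁
  commutativeRing = record { isCommutativeRing = isCommutativeRing }

  decTotalOrder : DecTotalOrder c ℓ₁ ℓ₂
  decTotalOrder = record { isDecTotalOrder = isDecTotalOrder }

-- All words of length n over the alphabet enumerated by a list, each
-- occurring once when the list has no repetitions.
words : ∀ {a} {A : Set a} → List A → (n : ℕ) → List (Vec A n)
words as zero    = [] ∷ []
words as (suc n) = cartesianProductWith _∷_ as (words as n)

-- Tuples in ℕ^p with sum n; their entries are automatically at most n.
tuples : (p n : ℕ) → List (Vec ℕ p)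
tuples p n = List.filter (λ k → Vec.sum k ℕ.≟ n) (words (upTo (suc n)) p)

∏! : ∀ {p} → Vec ℕ p → ℕ
∏! []       = 1
∏! (k ∷ ks) = k ! ℕ.* ∏! ks

∏!≢0 : ∀ {p} (k : Vec ℕ p) → NonZero (∏! k)
∏!≢0 []       = _
∏!≢0 (k ∷ ks) = ℕ.m*n≢0 (k !) (∏! ks) {{k ℕ.!≢0}} {{∏!≢0 ks}}

-- n! / (k₀! ⋯ kₚ₋₁!); the division is exact when the kᵢ sum to n.
multinomial : ∀ {p} → ℕ → Vec ℕ p → ℕ
multinomial n k = (n !) ℕ./ (∏! k)
  where instance _ = ∏!≢0 k

module Model {c ℓ₁ ℓ₂} (ℝ : CompleteOrderedField c ℓ₁ ℓ₂) (m : ℕ) where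

  open CompleteOrderedField ℝ public
    using (Carrier; _≈_; _≤_; _+_; _*_; -_; _⁻¹; 0#; 1#)
  open CommutativeRing (CompleteOrderedField.commutativeRing ℝ) public
    using (_-_; semiring)
  open RawSemiringDefs (Semiring.rawSemiring semiring) public
    using (_^_; product) renaming (sum to sumFin; _×_ to _·_)
  open Max (DecTotalOrder.totalOrder (CompleteOrderedField.decTotalOrder ℝ)) public
    using () renaming (_⊔_ to max)
  open ToStrict _≈_ _≤_ public using (_<_)

  infix 9 _⁺
  _⁺ : Carrier → Carrier
  t ⁺ = max t 0#

  ∑[_] : ∀ {a} {A : Set a} → List A → (A → Carrier) → Carrier
  ∑[ xs ] f = List.foldr (λ x s → f x + s) 0# xs

  -- Functions {1,…,m} → {0,1}, encoded by their tables of values so that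
  -- extensionally equal functions are propositionally equal; the argument
  -- i + 1 corresponds to the index i : Fin m.
  𝓛 : Set
  𝓛 = Vec (Fin 2) m

  all𝓛 : List 𝓛
  all𝓛 = words (allFin 2) m

  -- λ(i) for 0 ≤ i ≤ m, with λ(0) = 0.
  _⟨_⟩ : 𝓛 → Fin (suc m) → Fin 2
  λ₁ ⟨ i ⟩ = lookup (zero ∷ λ₁) i

  ⟪_,_⟫ : (𝓛 → Carrier) → (𝓛 → Carrier) → Carrier
  ⟪ x , y ⟫ = ∑[ all𝓛 ] λ λ₁ → x λ₁ * y λ₁

  ℓ : Fin (suc m) → 𝓛 → Carrier
  ℓ i λ₁ = (- 1#) ^ toℕ (λ₁ ⟨ i ⟩)

  record P (b : Fin m → Carrier) (x : 𝓛 → Carrier) : Set (ℓ₁ ⊔ ℓ₂) where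
    field
      nonNeg : ∀ λ₁ → 0# ≤ x λ₁
      mass   : ⟪ ℓ zero , x ⟫ ≈ 1#
      moment : ∀ i → ⟪ ℓ (suc i) , x ⟫ ≈ b i

  record ℓ-Positive (v : 𝓛 → Carrier) : Set (c ⊔ ℓ₁ ⊔ ℓ₂) where
    field
      a        : Fin (suc m) → Carrier
      expand   : ∀ λ₁ → v λ₁ ≈ sumFin (λ i → a i * ℓ i λ₁)
      positive : ∀ (i : Fin m) → 0# < a (suc i)

  -- Words of length < n.
  𝓣* : ℕ → Set
  𝓣* n = Σ[ k ∈ Fin n ] Vec 𝓛 (toℕ k)

  -- With 0-based k, the k-th letter is drawn from the density attached to
  -- the prefix of length k.
  pathDensity : ∀ {b n} → (𝓣* n → ∃ (P b)) → Vec 𝓛 n → Carrier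
  pathDensity Φ w =
    product λ k → proj₁ (Φ (k , truncate (Fin.toℕ≤n k) w)) (lookup w k)

  Γ : (n : ℕ) → (Fin m → Carrier) → Pred (Vec 𝓛 n → Carrier) (c ⊔ ℓ₁ ⊔ ℓ₂)
  Γ n b Q = Σ[ Φ ∈ (𝓣* n → ∃ (P b)) ] (∀ w → Q w ≈ pathDensity Φ w)

  𝔼 : ∀ {n} → (Vec 𝓛 n → Carrier) → (Vec 𝓛 n → Carrier) → Carrier
  𝔼 {n} Q F = ∑[ words all𝓛 n ] λ w → Q w * F w

  record IsFmin {n : ℕ} {ℓ′} (G : Pred (Vec 𝓛 n → Carrier) ℓ′)
                (F : Vec 𝓛 n → Carrier) (μ : Carrier) : Set (c ⊔ ℓ₁ ⊔ ℓ₂ ⊔ ℓ′) where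
    field
      attained   : ∃[ Q ] G Q × μ ≈ 𝔼 Q F
      lowerBound : ∀ Q → G Q → μ ≤ 𝔼 Q F

  european : ∀ {n r} → (Fin r → 𝓛 → Carrier) → (Fin r → Carrier) → Carrier →
             Vec 𝓛 n → Carrier
  european u s C w = (sumFin (λ j → s j * product λ k → u j (lookup w k)) - C) ⁺

  ν : Fin (suc m) → 𝓛
  ν i = tabulate λ j → if does (i Fin.≟ suc j) then zero else suc zero

  β : (Fin m → Carrier) → Fin (suc m) → Carrier
  β b zero    = 1#
  β b (suc i) = (1# + b i) * (1# + 1#) ⁻¹

  α : (𝓛 → Carrier) → Fin (suc m) → Carrier
  α u zero    = u (ν zero)
  α u (suc i) = u (ν (suc i)) - u (ν zero)

  multinomialBound : ∀ {r} → ℕ → (Fin m → Carrier) → (Fin r → 𝓛 → Carrier) →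
                     (Fin r → Carrier) → Carrier → Carrier
  multinomialBound n b u s C =
    ∑[ tuples (suc m) n ] λ k →
      multinomial n k ·
        (product (λ i → β b i ^ lookup k i)
          * (sumFin (λ j → s j * product λ i → α (u j) i ^ lookup k i) - C) ⁺)

{-# OPTIONS --safe #-}

-- Write u_j = ∑ᵢ α_j(i) eᵢ, where e₀ = 1 and eᵢ is the indicator of λ(i) = 0; ℓ-positivity and
-- u_j ≥ 0 make all α_j(i) nonnegative, and every density in P(b) gives eᵢ the mean β(i).
-- Expanding the products, the payoff at a word is (∑_I e_I A_I − C)⁺ over I ∈ {0,…,m}ⁿ, with
-- A_I = ∑_j s_j ∏ α_j(I_k) ≥ 0 and e_I ∈ {0,1}. Since t ↦ (t − C)⁺ is superadditive on t ≥ 0, this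
-- is at least ∑_I e_I (A_I − C)⁺, whose expectation under any element of Γ is
-- ∑_I ∏ β(I_k) (A_I − C)⁺; grouping the I by their letter counts gives the multinomial sum.
--
-- The minimum over Γ is attained by backward induction, choosing at each word a density that
-- minimises a linear functional over the polytope P(b). Such a minimiser is found by
-- Fourier–Motzkin elimination.
module Submission where

open import Defs
open import Level using (_⊔_)
open import Algebra.Bundles using (CommutativeSemiring; CommutativeRing)
import Algebra.Construct.NaturalChoice.Max as Max
import Algebra.Properties.CommutativeSemigroup
import Algebra.Properties.Ring
import Algebra.Properties.Semiring.Mult
import Algebra.Properties.Semiring.Sum
import Algebra.Solver.Ring.NaturalCoefficients.Default
open import Data.Bool.Base using (if_then_else_; true; false)
open import Data.Fin.Base using (Fin; zero; suc)
import Data.Fin.Properties as Fin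
open import Data.List.Base as List using (List; []; _∷_; _++_; allFin; upTo; cartesianProductWith)
open import Data.List.Membership.Propositional using (_∈_; find)
open import Data.List.Membership.Propositional.Properties
  using (∈-allFin; ∈-cartesianProductWith⁺; ∈-filter⁺; ∈-filter⁻; ∈-map⁺; ∈-upTo⁺; ∈-++⁺ˡ; ∈-++⁺ʳ)
open import Data.List.Relation.Unary.All as All using (All; []; _∷_)
import Data.List.Relation.Unary.All.Properties as All
open import Data.List.Relation.Unary.Any as Any using (Any; here; there)
import Data.List.Relation.Unary.Any.Properties as Any
open import Data.List.Relation.Unary.Unique.Propositional using (Unique; []; _∷_)
import Data.List.Relation.Unary.Unique.Propositional.Properties as Unique
open import Data.Nat.Base as ℕ using (ℕ; zero; suc; s≤s; _!; NonZero)
import Data.Nat.DivMod as ℕ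
import Data.Nat.Properties as ℕ
open import Data.Nat.Solver using (module +-*-Solver)
open import Data.Product.Base using (∃; ∃-syntax; ∃₂; _×_; _,_; proj₁; proj₂)
open import Data.Sum.Base using (_⊎_; inj₁; inj₂; [_,_]′)
open import Data.Vec.Base as Vec using (Vec; []; _∷_; lookup; updateAt)
import Data.Vec.Properties as Vec
open import Function.Base using (_∘_; id; flip)
open import Relation.Binary.Bundles using (DecTotalOrder)
open import Relation.Binary.Definitions using (DecidableEquality)
open import Relation.Binary.PropositionalEquality as ≡ using (_≡_; _≢_; refl; cong; cong₂)
import Relation.Binary.Reasoning.PartialOrder
import Relation.Binary.Reasoning.Setoid
open import Relation.Nullary using (yes; no; does; contradiction; ¬_)
open import Relation.Nullary.Decidable using (dec-true; dec-false)

-- Finite sums indexed by lists.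

module ListSum {c ℓ} (R : CommutativeSemiring c ℓ) where
  open CommutativeSemiring R renaming (refl to ≈-refl; sym to ≈-sym; trans to ≈-trans)
  open Algebra.Properties.Semiring.Sum semiring using (sum)
  open Algebra.Properties.Semiring.Mult semiring using (×-homo-+) renaming (_×_ to _·_)
  open Algebra.Properties.CommutativeSemigroup
    (CommutativeSemiring.+-commutativeSemigroup R) using (interchange)

  ∑[_] : ∀ {a} {A : Set a} → List A → (A → Carrier) → Carrier
  ∑[ xs ] f = List.foldr (λ x s → f x + s) 0# xs

  module _ {a} {A : Set a} where

    ∑-cong-∈ : ∀ (xs : List A) {f g} → (∀ x → x ∈ xs → f x ≈ g x) → ∑[ xs ] f ≈ ∑[ xs ] g
    ∑-cong-∈ []       f≈g = ≈-refl
    ∑-cong-∈ (x ∷ xs) f≈g = +-cong (f≈g x (here refl)) (∑-cong-∈ xs λ y y∈ → f≈g y (there y∈))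

    ∑-cong : ∀ (xs : List A) {f g} → (∀ x → f x ≈ g x) → ∑[ xs ] f ≈ ∑[ xs ] g
    ∑-cong xs f≈g = ∑-cong-∈ xs λ x _ → f≈g x

    ∑-zero : ∀ (xs : List A) → ∑[ xs ] (λ _ → 0#) ≈ 0#
    ∑-zero []       = ≈-refl
    ∑-zero (x ∷ xs) = ≈-trans (+-identityˡ _) (∑-zero xs)

    ∑-distrib-+ : ∀ (xs : List A) f g → ∑[ xs ] (λ x → f x + g x) ≈ ∑[ xs ] f + ∑[ xs ] g
    ∑-distrib-+ []       f g = ≈-sym (+-identityˡ 0#)
    ∑-distrib-+ (x ∷ xs) f g =
      ≈-trans (+-congˡ (∑-distrib-+ xs f g)) (interchange (f x) (g x) (∑[ xs ] f) (∑[ xs ] g))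

    *-distribˡ-∑ : ∀ (xs : List A) z f → z * ∑[ xs ] f ≈ ∑[ xs ] (λ x → z * f x)
    *-distribˡ-∑ []       z f = zeroʳ z
    *-distribˡ-∑ (x ∷ xs) z f = ≈-trans (distribˡ z (f x) _) (+-congˡ (*-distribˡ-∑ xs z f))

    *-distribʳ-∑ : ∀ (xs : List A) z f → ∑[ xs ] f * z ≈ ∑[ xs ] (λ x → f x * z)
    *-distribʳ-∑ []       z f = zeroˡ z
    *-distribʳ-∑ (x ∷ xs) z f = ≈-trans (distribʳ z (f x) _) (+-congˡ (*-distribʳ-∑ xs z f))

    ∑-++ : ∀ (xs ys : List A) f → ∑[ xs ++ ys ] f ≈ ∑[ xs ] f + ∑[ ys ] f
    ∑-++ []       ys f = ≈-sym (+-identityˡ _)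
    ∑-++ (x ∷ xs) ys f = ≈-trans (+-congˡ (∑-++ xs ys f)) (≈-sym (+-assoc (f x) _ _))

    ∑-tabulate : ∀ {n} (g : Fin n → A) f → ∑[ List.tabulate g ] f ≈ sum (f ∘ g)
    ∑-tabulate {zero}  g f = ≈-refl
    ∑-tabulate {suc n} g f = +-congˡ (∑-tabulate (g ∘ suc) f)

    ∑-·-distribʳ : ∀ (xs : List A) (f : A → ℕ) z →
                   List.foldr (λ x s → f x ℕ.+ s) 0 xs · z ≈ ∑[ xs ] λ x → f x · z
    ∑-·-distribʳ []       f z = ≈-refl
    ∑-·-distribʳ (x ∷ xs) f z = ≈-trans (×-homo-+ z (f x) _) (+-congˡ (∑-·-distribʳ xs f z))

  ∑-allFin : ∀ {n} (f : Fin n → Carrier) → ∑[ allFin n ] f ≈ sum f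
  ∑-allFin = ∑-tabulate id

  ∑-map : ∀ {a b} {A : Set a} {B : Set b} (g : A → B) xs f →
          ∑[ List.map g xs ] f ≈ ∑[ xs ] (f ∘ g)
  ∑-map g []       f = ≈-refl
  ∑-map g (x ∷ xs) f = +-congˡ (∑-map g xs f)

  ∑-comm : ∀ {a b} {A : Set a} {B : Set b} (xs : List A) (ys : List B) f →
           ∑[ xs ] (λ x → ∑[ ys ] (f x)) ≈ ∑[ ys ] (λ y → ∑[ xs ] (flip f y))
  ∑-comm []       ys f = ≈-sym (∑-zero ys)
  ∑-comm (x ∷ xs) ys f =
    ≈-trans (+-congˡ (∑-comm xs ys f)) (≈-sym (∑-distrib-+ ys (f x) _))

  ∑-cartesianProductWith :
    ∀ {a b d} {A : Set a} {B : Set b} {D : Set d} (g : A → B → D) xs ys f →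
    ∑[ cartesianProductWith g xs ys ] f ≈ ∑[ xs ] λ x → ∑[ ys ] λ y → f (g x y)
  ∑-cartesianProductWith g []       ys f = ≈-refl
  ∑-cartesianProductWith g (x ∷ xs) ys f =
    ≈-trans (∑-++ (List.map (g x) ys) _ f)
            (+-cong (∑-map (g x) ys f) (∑-cartesianProductWith g xs ys f))

-- The Kronecker delta and its sifting property.

module _ {a} {A : Set a} (_≟_ : DecidableEquality A) where

  δ : A → A → ℕ
  δ x y = if does (x ≟ y) then 1 else 0

  δ-refl : ∀ x → δ x x ≡ 1
  δ-refl x = cong (λ b → if b then 1 else 0) (dec-true (x ≟ x) refl)

  δ-≢ : ∀ {x y} → x ≢ y → δ x y ≡ 0
  δ-≢ {x} {y} x≢y = cong (λ b → if b then 1 else 0) (dec-false (x ≟ y) x≢y)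

  module _ {c ℓ} (R : CommutativeSemiring c ℓ) where
    open CommutativeSemiring R renaming (refl to ≈-refl; sym to ≈-sym; trans to ≈-trans)
    open Algebra.Properties.Semiring.Mult semiring using (×-congˡ; ×-homo-1) renaming (_×_ to _·_)
    open ListSum R

    -- Without repetitions the index `x` is met exactly once, so every other term carries the factor
    -- 0. This lets a value be rewritten as a sum over a list, which `∑-counts` needs before
    -- exchanging sums.
    ∑-δ : ∀ {xs} → Unique xs → ∀ {x} → x ∈ xs → (f : A → Carrier) →
          ∑[ xs ] (λ y → δ x y · f y) ≈ f x
    ∑-δ {y ∷ xs} (y∉ ∷ u) {x} (here refl) f =
      ≈-trans (+-cong (≈-trans (×-congˡ (δ-refl x)) (×-homo-1 (f x)))
                      (≈-trans (∑-cong-∈ xs λ z z∈ → ×-congˡ (δ-≢ (All.lookup y∉ z∈)))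
                               (∑-zero xs)))
              (+-identityʳ (f x))
    ∑-δ {y ∷ xs} (y∉ ∷ u) {x} (there x∈) f =
      ≈-trans (+-cong (×-congˡ (δ-≢ λ { refl → All.lookup y∉ x∈ refl })) (∑-δ u x∈ f))
              (+-identityˡ (f x))

-- Completeness and non-repetition of the lists of words and tuples.

∈-words : ∀ {a} {A : Set a} {as : List A} {n} (w : Vec A n) →
          (∀ i → lookup w i ∈ as) → w ∈ words as n
∈-words []      w∈ = here refl
∈-words (x ∷ w) w∈ = ∈-cartesianProductWith⁺ _∷_ (w∈ zero) (∈-words w (w∈ ∘ suc))

words-unique : ∀ {a} {A : Set a} {as : List A} → Unique as → ∀ n → Unique (words as n)
words-unique u zero    = [] ∷ []
words-unique u (suc n) = Unique.cartesianProductWith⁺ _∷_ Vec.∷-injective u (words-unique u n)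

lookup≤sum : ∀ {p} (k : Vec ℕ p) i → lookup k i ℕ.≤ Vec.sum k
lookup≤sum (x ∷ k) zero    = ℕ.m≤m+n x _
lookup≤sum (x ∷ k) (suc i) = ℕ.≤-trans (lookup≤sum k i) (ℕ.m≤n+m _ x)

tuples-unique : ∀ p n → Unique (tuples p n)
tuples-unique p n = Unique.filter⁺ _ (words-unique (Unique.upTo⁺ (suc n)) p)

-- No entry of a vector of naturals exceeds its sum, so the range `upTo (suc n)` used by `tuples` is
-- wide enough.
∈-tuples : ∀ {p n} (k : Vec ℕ p) → Vec.sum k ≡ n → k ∈ tuples p n
∈-tuples k refl =
  ∈-filter⁺ _ (∈-words k λ i → ∈-upTo⁺ (ℕ.s≤s (lookup≤sum k i))) refl

∈-tuples⇒sum≡ : ∀ {p n} {k : Vec ℕ p} → k ∈ tuples p n → Vec.sum k ≡ n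
∈-tuples⇒sum≡ {p} {n} k∈ =
  proj₂ (∈-filter⁻ (λ k → Vec.sum k ℕ.≟ n) {xs = words (upTo (suc n)) p} k∈)

-- Letter counts and multinomial coefficients.

counts : ∀ {p n} → Vec (Fin p) n → Vec ℕ p
counts []      = Vec.replicate _ 0
counts (i ∷ I) = updateAt (counts I) i suc

sum-replicate-0 : ∀ p → Vec.sum (Vec.replicate p 0) ≡ 0
sum-replicate-0 zero    = refl
sum-replicate-0 (suc p) = sum-replicate-0 p

sum≡0⇒replicate : ∀ {p} (k : Vec ℕ p) → Vec.sum k ≡ 0 → k ≡ Vec.replicate p 0
sum≡0⇒replicate []         _  = refl
sum≡0⇒replicate (zero ∷ k) eq = cong (0 ∷_) (sum≡0⇒replicate k eq)

∏!-replicate-0 : ∀ p → ∏! (Vec.replicate p 0) ≡ 1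
∏!-replicate-0 zero    = refl
∏!-replicate-0 (suc p) = ≡.trans (ℕ.+-identityʳ _) (∏!-replicate-0 p)

sum-updateAt-suc : ∀ {p} (k : Vec ℕ p) i → Vec.sum (updateAt k i suc) ≡ suc (Vec.sum k)
sum-updateAt-suc (x ∷ k) zero    = refl
sum-updateAt-suc (x ∷ k) (suc i) =
  ≡.trans (cong (x ℕ.+_) (sum-updateAt-suc k i)) (ℕ.+-suc x _)

∏!-updateAt-suc : ∀ {p} (k : Vec ℕ p) i → ∏! (updateAt k i suc) ≡ suc (lookup k i) ℕ.* ∏! k
∏!-updateAt-suc (x ∷ k) zero    = ℕ.*-assoc (suc x) (x !) (∏! k)
∏!-updateAt-suc (x ∷ k) (suc i) = ≡.trans (cong (x ! ℕ.*_) (∏!-updateAt-suc k i))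
  (solve 3 (λ a b d → a :* (b :* d) := b :* (a :* d)) refl (x !) (suc (lookup k i)) (∏! k))
  where open +-*-Solver

updateAt-suc-injective : ∀ {p} (k l : Vec ℕ p) i → updateAt k i suc ≡ updateAt l i suc → k ≡ l
updateAt-suc-injective (x ∷ k) (y ∷ l) zero    eq =
  cong₂ _∷_ (ℕ.suc-injective (Vec.∷-injectiveˡ eq)) (Vec.∷-injectiveʳ eq)
updateAt-suc-injective (x ∷ k) (y ∷ l) (suc i) eq =
  cong₂ _∷_ (Vec.∷-injectiveˡ eq) (updateAt-suc-injective k l i (Vec.∷-injectiveʳ eq))

-- Decides whether a word with counts `k` can begin with the letter `i`; if it can, `l` gives the
-- counts of the remaining letters.
updateAt-suc-view : ∀ {p} (k : Vec ℕ p) i →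
                    lookup k i ≡ 0 ⊎ ∃[ l ] k ≡ updateAt l i suc
updateAt-suc-view (zero  ∷ k) zero    = inj₁ refl
updateAt-suc-view (suc x ∷ k) zero    = inj₂ (x ∷ k , refl)
updateAt-suc-view (x     ∷ k) (suc i) with updateAt-suc-view k i
... | inj₁ eq         = inj₁ eq
... | inj₂ (l , refl) = inj₂ (x ∷ l , refl)

sum-counts : ∀ {p n} (I : Vec (Fin p) n) → Vec.sum (counts I) ≡ n
sum-counts {p} []      = sum-replicate-0 p
sum-counts     (i ∷ I) = ≡.trans (sum-updateAt-suc (counts I) i) (cong suc (sum-counts I))

private
  module ∑ℕ = ListSum ℕ.+-*-commutativeSemiring
  open ∑ℕ using () renaming (∑[_] to ∑ℕ[_])

_≟ᵛ_ : ∀ {p} → DecidableEquality (Vec ℕ p)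
_≟ᵛ_ = Vec.≡-dec ℕ._≟_

-- The number of words with letter counts `k`. As a sum of deltas it can be split along the first
-- letter by the same lemmas as any other sum.
arrangements : ∀ {p} → ℕ → Vec ℕ p → ℕ
arrangements {p} n k = ∑ℕ[ words (allFin p) n ] λ I → δ _≟ᵛ_ (counts I) k

∑-lookup : ∀ {p} (k : Vec ℕ p) → ∑ℕ[ allFin p ] (lookup k) ≡ Vec.sum k
∑-lookup {p} k = ≡.trans (∑ℕ.∑-allFin (lookup k)) (go k)
  where
  open Algebra.Properties.Semiring.Sum ℕ.+-*-semiring using (sum)
  go : ∀ {p} (k : Vec ℕ p) → sum (lookup k) ≡ Vec.sum k
  go []      = refl
  go (x ∷ k) = cong (x ℕ.+_) (go k)

-- Classify the words by their first letter `i`. Deleting it leaves the words of length `n` whose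
-- counts have one `i` fewer, and the factorial of the `i`-th count loses the factor `lookup k i`;
-- so by induction this class contributes `lookup k i * n !`. The counts sum to `suc n`, which gives
-- the factorial of `suc n`. The product form postpones division to `arrangements≡multinomial`.
∏!-*-arrangements : ∀ {p} n (k : Vec ℕ p) → Vec.sum k ≡ n → ∏! k ℕ.* arrangements n k ≡ n !
∏!-*-arrangements {p} zero k eq with refl ← sum≡0⇒replicate k eq =
  cong₂ ℕ._*_ (∏!-replicate-0 p)
    (≡.trans (ℕ.+-identityʳ _) (δ-refl _≟ᵛ_ (Vec.replicate p 0)))
∏!-*-arrangements {p} (suc n) k eq = begin
  ∏! k ℕ.* arrangements (suc n) k
    ≡⟨ cong (∏! k ℕ.*_) (∑ℕ.∑-cartesianProductWith _∷_ (allFin p) _ _) ⟩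
  ∏! k ℕ.* ∑ℕ[ allFin p ] first
    ≡⟨ ∑ℕ.*-distribˡ-∑ (allFin p) (∏! k) first ⟩
  ∑ℕ[ allFin p ] (λ i → ∏! k ℕ.* first i)
    ≡⟨ ∑ℕ.∑-cong (allFin p) step ⟩
  ∑ℕ[ allFin p ] (λ i → lookup k i ℕ.* n !)
    ≡⟨ ∑ℕ.*-distribʳ-∑ (allFin p) (n !) (lookup k) ⟨
  ∑ℕ[ allFin p ] (lookup k) ℕ.* n !
    ≡⟨ cong (ℕ._* n !) (≡.trans (∑-lookup k) eq) ⟩
  suc n ! ∎
  where
  open ≡.≡-Reasoning
  first : Fin p → ℕ
  first i = ∑ℕ[ words (allFin p) n ] λ I → δ _≟ᵛ_ (updateAt (counts I) i suc) k
  step : ∀ i → ∏! k ℕ.* first i ≡ lookup k i ℕ.* n !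
  step i with updateAt-suc-view k i
  -- A word that starts with `i` has a positive count at `i`, so no word contributes and both sides
  -- are 0.
  ... | inj₁ kᵢ≡0 = ≡.trans
    (cong (∏! k ℕ.*_) (≡.trans
      (∑ℕ.∑-cong (words (allFin p) n) λ I →
        δ-≢ _≟ᵛ_ {updateAt (counts I) i suc} {k} λ { refl →
          ℕ.1+n≢0 (≡.trans (≡.sym (Vec.lookup∘updateAt i (counts I))) kᵢ≡0) })
      (∑ℕ.∑-zero (words (allFin p) n))))
    (≡.trans (ℕ.*-zeroʳ (∏! k)) (cong (ℕ._* n !) (≡.sym kᵢ≡0)))
  ... | inj₂ (l , refl) = begin
    ∏! (updateAt l i suc) ℕ.* first i
      ≡⟨ cong₂ ℕ._*_ (∏!-updateAt-suc l i) (∑ℕ.∑-cong (words (allFin p) n) λ I → δ-suc (counts I)) ⟩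
    suc (lookup l i) ℕ.* ∏! l ℕ.* arrangements n l
      ≡⟨ ℕ.*-assoc (suc (lookup l i)) (∏! l) (arrangements n l) ⟩
    suc (lookup l i) ℕ.* (∏! l ℕ.* arrangements n l)
      ≡⟨ cong₂ ℕ._*_ (≡.sym (Vec.lookup∘updateAt i l))
           (∏!-*-arrangements n l (ℕ.suc-injective (≡.trans (≡.sym (sum-updateAt-suc l i)) eq))) ⟩
    lookup (updateAt l i suc) i ℕ.* n ! ∎
    where
    δ-suc : ∀ c → δ _≟ᵛ_ (updateAt c i suc) (updateAt l i suc) ≡ δ _≟ᵛ_ c l
    δ-suc c with c ≟ᵛ l
    ... | yes refl = δ-refl _≟ᵛ_ (updateAt l i suc)
    ... | no  c≢l  = δ-≢ _≟ᵛ_ (c≢l ∘ updateAt-suc-injective c l i)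

arrangements≡multinomial : ∀ {p} n (k : Vec ℕ p) → Vec.sum k ≡ n →
                           arrangements n k ≡ multinomial n k
arrangements≡multinomial n k eq =
  ≡.trans (≡.sym (ℕ.m*n/n≡m (arrangements n k) (∏! k)))
    (cong (ℕ._/ ∏! k) (≡.trans (ℕ.*-comm (arrangements n k) (∏! k)) (∏!-*-arrangements n k eq)))
  where instance _ = ∏!≢0 k

module _ {c ℓ} (R : CommutativeSemiring c ℓ) where
  open CommutativeSemiring R renaming (refl to ≈-refl; sym to ≈-sym; trans to ≈-trans)
  open Algebra.Properties.Semiring.Mult semiring using (×-congˡ) renaming (_×_ to _·_)
  open ListSum R
  open Relation.Binary.Reasoning.Setoid setoid

  -- Replace each `f (counts I)` by a delta-weighted sum over tuples and exchange the two sums. The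
  -- inner sum over words then counts the arrangements of `k`.
  ∑-counts : ∀ p n (f : Vec ℕ p → Carrier) →
             ∑[ words (allFin p) n ] (f ∘ counts) ≈ ∑[ tuples p n ] λ k → multinomial n k · f k
  ∑-counts p n f = begin
    ∑[ words (allFin p) n ] (f ∘ counts)
      ≈⟨ ∑-cong (words (allFin p) n) (λ I →
           ∑-δ _≟ᵛ_ R (tuples-unique p n) (∈-tuples (counts I) (sum-counts I)) f) ⟨
    ∑[ words (allFin p) n ] (λ I → ∑[ tuples p n ] λ k → δ _≟ᵛ_ (counts I) k · f k)
      ≈⟨ ∑-comm (words (allFin p) n) (tuples p n) _ ⟩
    ∑[ tuples p n ] (λ k → ∑[ words (allFin p) n ] λ I → δ _≟ᵛ_ (counts I) k · f k)
      ≈⟨ ∑-cong-∈ (tuples p n) (λ k k∈ → ≈-trans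
           (≈-sym (∑-·-distribʳ (words (allFin p) n) _ (f k)))
           (×-congˡ (arrangements≡multinomial n k (∈-tuples⇒sum≡ {n = n} k∈)))) ⟩
    ∑[ tuples p n ] (λ k → multinomial n k · f k) ∎

-- Arithmetic of ordered fields and of the positive part.

module OrderedField {c ℓ₁ ℓ₂} (ℝ : CompleteOrderedField c ℓ₁ ℓ₂) (m : ℕ) where

  open Model ℝ m public
  open CompleteOrderedField ℝ public
    using (commutativeRing; decTotalOrder; 0≉1; *-inverseʳ; +-monoˡ-≤; *-nonNeg)
  open CommutativeRing commutativeRing public
    using (commutativeSemiring; ring; +-cong; +-congˡ; +-congʳ; *-cong; *-congˡ; *-congʳ; -‿cong;
           +-comm; +-assoc; *-comm; *-assoc; +-identityˡ; +-identityʳ; *-identityˡ; *-identityʳ;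
           -‿inverseˡ; -‿inverseʳ; distribˡ; distribʳ; zeroˡ; zeroʳ)
    renaming (refl to ≈-refl; sym to ≈-sym; trans to ≈-trans; reflexive to ≈-reflexive)
  open DecTotalOrder decTotalOrder public using (poset; total; _≤?_)
    renaming (refl to ≤-refl; trans to ≤-trans; reflexive to ≤-reflexive; antisym to ≤-antisym)
  open Algebra.Properties.Ring ring public
    using (-‿distribˡ-*; -‿distribʳ-*; -‿involutive; -1*x≈-x; +-cancelʳ)
  open Algebra.Properties.Semiring.Sum semiring public
    using (sum-cong-≋; *-distribˡ-sum)
    renaming (∑-distrib-+ to sum-distrib-+)
  open Max (DecTotalOrder.totalOrder decTotalOrder) public
    using (⊔-lub; x≤x⊔y; x≤y⊔x; ⊔-cong; x≤y⇒x⊔y≈y; x≤y⇒y⊔x≈y)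
  open ListSum commutativeSemiring public hiding (∑[_])
  open Algebra.Solver.Ring.NaturalCoefficients.Default commutativeSemiring public
    using (solve; _:=_; _:+_; _:*_; con)
  open Relation.Binary.Reasoning.PartialOrder poset public

  +-mono-≤ : ∀ {x y u v} → x ≤ y → u ≤ v → x + u ≤ y + v
  +-mono-≤ {x} {y} {u} {v} x≤y u≤v = begin
    x + u ≤⟨ +-monoˡ-≤ u x≤y ⟩
    y + u ≈⟨ +-comm y u ⟩
    u + y ≤⟨ +-monoˡ-≤ y u≤v ⟩
    v + y ≈⟨ +-comm v y ⟩
    y + v ∎

  +-nonNeg : ∀ {x y} → 0# ≤ x → 0# ≤ y → 0# ≤ x + y
  +-nonNeg {x} {y} 0≤x 0≤y = begin
    0#      ≈⟨ +-identityˡ 0# ⟨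
    0# + 0# ≤⟨ +-mono-≤ 0≤x 0≤y ⟩
    x + y   ∎

  x≈0⇒x*y≈0 : ∀ {x y} → x ≈ 0# → x * y ≈ 0#
  x≈0⇒x*y≈0 x≈0 = ≈-trans (*-congʳ x≈0) (zeroˡ _)

  x≈1⇒x*y≈y : ∀ {x y} → x ≈ 1# → x * y ≈ y
  x≈1⇒x*y≈y x≈1 = ≈-trans (*-congʳ x≈1) (*-identityˡ _)

  y≤x+y : ∀ {x y} → 0# ≤ x → y ≤ x + y
  y≤x+y {x} {y} 0≤x = ≤-trans (≤-reflexive (≈-sym (+-identityˡ y))) (+-monoˡ-≤ y 0≤x)

  x≤x+y : ∀ {x y} → 0# ≤ y → x ≤ x + y
  x≤x+y {x} {y} 0≤y = ≤-trans (y≤x+y 0≤y) (≤-reflexive (+-comm y x))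

  x-y+y≈x : ∀ x y → x - y + y ≈ x
  x-y+y≈x x y = begin-equality
    x - y + y     ≈⟨ +-assoc x (- y) y ⟩
    x + (- y + y) ≈⟨ +-congˡ (-‿inverseˡ y) ⟩
    x + 0#        ≈⟨ +-identityʳ x ⟩
    x             ∎

  x+y-y≈x : ∀ x y → x + y - y ≈ x
  x+y-y≈x x y = begin-equality
    x + y - y   ≈⟨ +-assoc x y (- y) ⟩
    x + (y - y) ≈⟨ +-congˡ (-‿inverseʳ y) ⟩
    x + 0#      ≈⟨ +-identityʳ x ⟩
    x           ∎

  +-cancelʳ-≤ : ∀ {x y} z → x + z ≤ y + z → x ≤ y
  +-cancelʳ-≤ {x} {y} z x+z≤y+z = begin
    x         ≈⟨ x+y-y≈x x z ⟨
    x + z - z ≤⟨ +-monoˡ-≤ (- z) x+z≤y+z ⟩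
    y + z - z ≈⟨ x+y-y≈x y z ⟩
    y         ∎

  x≤y⇒x-y≤0 : ∀ {x y} → x ≤ y → x - y ≤ 0#
  x≤y⇒x-y≤0 {x} {y} x≤y = ≤-trans (+-monoˡ-≤ (- y) x≤y) (≤-reflexive (-‿inverseʳ y))

  x≤y⇒0≤y-x : ∀ {x y} → x ≤ y → 0# ≤ y - x
  x≤y⇒0≤y-x {x} {y} x≤y = begin
    0#    ≈⟨ -‿inverseʳ x ⟨
    x - x ≤⟨ +-monoˡ-≤ (- x) x≤y ⟩
    y - x ∎

  0≤y-x⇒x≤y : ∀ {x y} → 0# ≤ y - x → x ≤ y
  0≤y-x⇒x≤y {x} {y} 0≤y-x = begin
    x         ≈⟨ +-identityˡ x ⟨
    0# + x    ≤⟨ +-monoˡ-≤ x 0≤y-x ⟩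
    y - x + x ≈⟨ x-y+y≈x y x ⟩
    y         ∎

  x≤0⇒0≤-x : ∀ {x} → x ≤ 0# → 0# ≤ - x
  x≤0⇒0≤-x {x} x≤0 = ≤-trans (x≤y⇒0≤y-x x≤0) (≤-reflexive (+-identityˡ (- x)))

  *-monoˡ-≤ : ∀ {x y z} → 0# ≤ z → x ≤ y → z * x ≤ z * y
  *-monoˡ-≤ {x} {y} {z} 0≤z x≤y = 0≤y-x⇒x≤y (begin
    0#                ≤⟨ *-nonNeg 0≤z (x≤y⇒0≤y-x x≤y) ⟩
    z * (y - x)       ≈⟨ distribˡ z y (- x) ⟩
    z * y + z * - x   ≈⟨ +-congˡ (-‿distribʳ-* z x) ⟨
    z * y - z * x     ∎)

  x≤0⇒z*x≤0 : ∀ {x z} → 0# ≤ z → x ≤ 0# → z * x ≤ 0#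
  x≤0⇒z*x≤0 {x} {z} 0≤z x≤0 = ≤-trans (*-monoˡ-≤ 0≤z x≤0) (≤-reflexive (zeroʳ z))

  -- In the case `1# ≤ 0#`, the product of two copies of the nonnegative `- 1#` is nonnegative, and
  -- it equals `1#`.
  0≤1 : 0# ≤ 1#
  0≤1 with total 0# 1#
  ... | inj₁ 0≤1 = 0≤1
  ... | inj₂ 1≤0 = begin
    0#          ≤⟨ *-nonNeg (x≤0⇒0≤-x 1≤0) (x≤0⇒0≤-x 1≤0) ⟩
    - 1# * - 1# ≈⟨ -‿distribˡ-* 1# (- 1#) ⟨
    - (1# * - 1#) ≈⟨ -‿cong (*-identityˡ (- 1#)) ⟩
    - - 1#      ≈⟨ -‿involutive 1# ⟩
    1#          ∎

  0<⊎≤0 : ∀ x → 0# < x ⊎ x ≤ 0#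
  0<⊎≤0 x with x ≤? 0#
  ... | yes x≤0 = inj₂ x≤0
  ... | no  x≰0 with total 0# x
  ...   | inj₁ 0≤x = inj₁ (0≤x , λ 0≈x → x≰0 (≤-reflexive (≈-sym 0≈x)))
  ...   | inj₂ x≤0 = inj₂ x≤0

  <⇒≱ : ∀ {x y} → x < y → ¬ (y ≤ x)
  <⇒≱ (x≤y , x≉y) y≤x = x≉y (≤-antisym x≤y y≤x)

  0<x⇒x*x⁻¹≈1 : ∀ {x} → 0# < x → x * x ⁻¹ ≈ 1#
  0<x⇒x*x⁻¹≈1 {x} (_ , 0≉x) = *-inverseʳ x (0≉x ∘ ≈-sym)

  -- A nonpositive inverse would make `1#`, the product of `x` and its inverse, nonpositive.
  0<x⇒0≤x⁻¹ : ∀ {x} → 0# < x → 0# ≤ x ⁻¹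
  0<x⇒0≤x⁻¹ {x} 0<x@(0≤x , 0≉x) with total 0# (x ⁻¹)
  ... | inj₁ 0≤x⁻¹ = 0≤x⁻¹
  ... | inj₂ x⁻¹≤0 = contradiction (≤-antisym 0≤1 (begin
    1#       ≈⟨ 0<x⇒x*x⁻¹≈1 0<x ⟨
    x * x ⁻¹ ≤⟨ x≤0⇒z*x≤0 0≤x x⁻¹≤0 ⟩
    0#       ∎)) 0≉1

  x⁻¹*[x*y]≈y : ∀ {x} y → 0# < x → x ⁻¹ * (x * y) ≈ y
  x⁻¹*[x*y]≈y {x} y 0<x = begin-equality
    x ⁻¹ * (x * y) ≈⟨ solve 3 (λ x i y → i :* (x :* y) := x :* i :* y) ≈-refl x (x ⁻¹) y ⟩
    x * x ⁻¹ * y   ≈⟨ *-congʳ (0<x⇒x*x⁻¹≈1 0<x) ⟩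
    1# * y         ≈⟨ *-identityˡ y ⟩
    y              ∎

  *-cancelˡ-≤ : ∀ {x y z} → 0# < z → z * x ≤ z * y → x ≤ y
  *-cancelˡ-≤ {x} {y} {z} 0<z zx≤zy = begin
    x              ≈⟨ x⁻¹*[x*y]≈y x 0<z ⟨
    z ⁻¹ * (z * x) ≤⟨ *-monoˡ-≤ (0<x⇒0≤x⁻¹ 0<z) zx≤zy ⟩
    z ⁻¹ * (z * y) ≈⟨ x⁻¹*[x*y]≈y y 0<z ⟩
    y              ∎

  module _ {a} {A : Set a} where

    ∑-mono-≤ : ∀ (xs : List A) {f g} → (∀ x → f x ≤ g x) → ∑[ xs ] f ≤ ∑[ xs ] g
    ∑-mono-≤ []       f≤g = ≤-refl
    ∑-mono-≤ (x ∷ xs) f≤g = +-mono-≤ (f≤g x) (∑-mono-≤ xs f≤g)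

    ∑-nonNeg : ∀ (xs : List A) {f} → (∀ x → 0# ≤ f x) → 0# ≤ ∑[ xs ] f
    ∑-nonNeg []       0≤f = ≤-refl
    ∑-nonNeg (x ∷ xs) 0≤f = +-nonNeg (0≤f x) (∑-nonNeg xs 0≤f)

  sumFin-nonNeg : ∀ {n} {f : Fin n → Carrier} → (∀ i → 0# ≤ f i) → 0# ≤ sumFin f
  sumFin-nonNeg {zero}  0≤f = ≤-refl
  sumFin-nonNeg {suc n} 0≤f = +-nonNeg (0≤f zero) (sumFin-nonNeg (0≤f ∘ suc))

  product-nonNeg : ∀ {n} {f : Fin n → Carrier} → (∀ i → 0# ≤ f i) → 0# ≤ product f
  product-nonNeg {zero}  0≤f = 0≤1
  product-nonNeg {suc n} 0≤f = *-nonNeg (0≤f zero) (product-nonNeg (0≤f ∘ suc))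

  product-cong : ∀ {n} {f g : Fin n → Carrier} → (∀ i → f i ≈ g i) → product f ≈ product g
  product-cong {zero}  f≈g = ≈-refl
  product-cong {suc n} f≈g = *-cong (f≈g zero) (product-cong (f≈g ∘ suc))

  0≤x⁺ : ∀ x → 0# ≤ x ⁺
  0≤x⁺ x = x≤y⊔x x 0#

  0≤x⇒x⁺≈x : ∀ {x} → 0# ≤ x → x ⁺ ≈ x
  0≤x⇒x⁺≈x = x≤y⇒y⊔x≈y

  x≤0⇒x⁺≈0 : ∀ {x} → x ≤ 0# → x ⁺ ≈ 0#
  x≤0⇒x⁺≈0 = x≤y⇒x⊔y≈y

  ⁺-cong : ∀ {x y} → x ≈ y → x ⁺ ≈ y ⁺
  ⁺-cong x≈y = ⊔-cong x≈y ≈-refl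

  ⁺-mono-≤ : ∀ {x y} → x ≤ y → x ⁺ ≤ y ⁺
  ⁺-mono-≤ {x} {y} x≤y = ⊔-lub (≤-trans x≤y (x≤x⊔y y 0#)) (0≤x⁺ y)

  *-antimonoˡ-≤ : ∀ {x y z} → z ≤ 0# → x ≤ y → z * y ≤ z * x
  *-antimonoˡ-≤ {x} {y} {z} z≤0 x≤y = 0≤y-x⇒x≤y (begin
    0#                    ≤⟨ *-nonNeg (x≤0⇒0≤-x z≤0) (x≤y⇒0≤y-x x≤y) ⟩
    - z * (y - x)         ≈⟨ distribˡ (- z) y (- x) ⟩
    - z * y + - z * - x
      ≈⟨ +-cong (-‿distribˡ-* z y)
           (≈-trans (-‿cong (-‿distribʳ-* z x)) (-‿distribˡ-* z (- x))) ⟨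
    - (z * y) - - (z * x) ≈⟨ +-congˡ (-‿involutive (z * x)) ⟩
    - (z * y) + z * x     ≈⟨ +-comm _ _ ⟩
    z * x - z * y         ∎)

-- Linear minimisation by Fourier-Motzkin elimination.

module LinearProgram {c ℓ₁ ℓ₂} (ℝ : CompleteOrderedField c ℓ₁ ℓ₂) (m : ℕ) where

  open OrderedField ℝ m

  p*[p⁻¹*-e]+e≈0 : ∀ {p} e → 0# < p → p * (p ⁻¹ * - e) + e ≈ 0#
  p*[p⁻¹*-e]+e≈0 {p} e 0<p = begin-equality
    p * (p ⁻¹ * - e) + e ≈⟨ +-congʳ (*-assoc p (p ⁻¹) (- e)) ⟨
    p * p ⁻¹ * - e + e   ≈⟨ +-congʳ (*-congʳ (0<x⇒x*x⁻¹≈1 0<p)) ⟩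
    1# * - e + e         ≈⟨ +-congʳ (*-identityˡ (- e)) ⟩
    - e + e              ≈⟨ -‿inverseˡ e ⟩
    0#                   ∎

  -- A pair `(p , e)` with `0# < p` is the lower bound `- e / p`, and `v` is the maximum of 0 and
  -- all these bounds. Pairs with nonpositive `p` put no condition on `v` here. The third clause
  -- records which bound is attained, as `eliminate-complete` needs to know it.
  leastSolution : (S : List (Carrier × Carrier)) → ∃[ v ]
    0# ≤ v ×
    All (λ (p , e) → 0# < p → 0# ≤ p * v + e) S ×
    (v ≈ 0# ⊎ Any (λ (p , e) → 0# < p × p * v + e ≈ 0#) S) ×
    (∀ w → 0# ≤ w → All (λ (p , e) → 0# ≤ p * w + e) S → v ≤ w)
  leastSolution [] = 0# , ≤-refl , [] , inj₁ ≈-refl , λ _ 0≤w _ → 0≤w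
  leastSolution ((p , e) ∷ S) with leastSolution S | 0<⊎≤0 p
  ... | v , 0≤v , pos , tight , least | inj₂ p≤0 =
    v , 0≤v , (λ 0<p → contradiction p≤0 (<⇒≱ 0<p)) ∷ pos , [ inj₁ , inj₂ ∘ there ]′ tight ,
    λ { w 0≤w (_ ∷ sat) → least w 0≤w sat }
  ... | v , 0≤v , pos , tight , least | inj₁ 0<p with total (p ⁻¹ * - e) v
  ...   | inj₁ L≤v =
    v , 0≤v , (λ _ → begin
      0#                   ≈⟨ p*[p⁻¹*-e]+e≈0 e 0<p ⟨
      p * (p ⁻¹ * - e) + e ≤⟨ +-monoˡ-≤ e (*-monoˡ-≤ (proj₁ 0<p) L≤v) ⟩
      p * v + e            ∎) ∷ pos ,
    [ inj₁ , inj₂ ∘ there ]′ tight ,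
    λ { w 0≤w (_ ∷ sat) → least w 0≤w sat }
  ...   | inj₂ v≤L =
    L , ≤-trans 0≤v v≤L ,
    (λ _ → ≤-reflexive (≈-sym root)) ∷
      All.map (λ sat 0<q → ≤-trans (sat 0<q) (+-monoˡ-≤ _ (*-monoˡ-≤ (proj₁ 0<q) v≤L))) pos ,
    inj₂ (here (0<p , root)) ,
    -- `L` is the root of `p * v + e`, so the constraint at `w` reads `p * L + e ≤ p * w + e`;
    -- cancel `e` and `p`.
    λ { w 0≤w (sat ∷ _) → *-cancelˡ-≤ 0<p (+-cancelʳ-≤ e (≤-trans (≤-reflexive root) sat)) }
    where
    L = p ⁻¹ * - e
    root = p*[p⁻¹*-e]+e≈0 e 0<p

  module _ {a} {A : Set a} where

    -- The affine inequality 0 ≤ ∑ₐ coeff(a) x(a) + slope t + const in the unknowns x and t.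
    record Constraint : Set (c ⊔ a) where
      field
        coeff : A → Carrier
        slope : Carrier
        const : Carrier

    open Constraint

    value : List A → Constraint → (A → Carrier) → Carrier → Carrier
    value as F x t = ∑[ as ] (λ a → coeff F a * x a) + (slope F * t + const F)

    combine : Carrier → Carrier → Constraint → Constraint → Constraint
    combine y z F G = record
      { coeff = λ a → y * coeff F a + z * coeff G a
      ; slope = y * slope F + z * slope G
      ; const = y * const F + z * const G
      }

    value-combine : ∀ as y z F G x t →
                    value as (combine y z F G) x t ≈ y * value as F x t + z * value as G x t
    value-combine []       y z F G x t =
      solve 7 (λ y z d d′ e e′ t →
          con 0 :+ ((y :* d :+ z :* d′) :* t :+ (y :* e :+ z :* e′)) :=
          y :* (con 0 :+ (d :* t :+ e)) :+ z :* (con 0 :+ (d′ :* t :+ e′)))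
        ≈-refl y z (slope F) (slope G) (const F) (const G) t
    value-combine (a ∷ as) y z F G x t = begin-equality
      (y * p + z * q) * x a + ∑[ as ] (λ a → coeff H a * x a) + (slope H * t + const H)
        ≈⟨ +-assoc _ _ _ ⟩
      (y * p + z * q) * x a + value as H x t
        ≈⟨ +-congˡ (value-combine as y z F G x t) ⟩
      (y * p + z * q) * x a + (y * value as F x t + z * value as G x t)
        ≈⟨ solve 9 (λ y z p q x f e g e′ →
             (y :* p :+ z :* q) :* x :+ (y :* (f :+ e) :+ z :* (g :+ e′)) :=
             y :* (p :* x :+ f :+ e) :+ z :* (q :* x :+ g :+ e′))
           ≈-refl y z p q (x a) _ _ _ _ ⟩
      y * value (a ∷ as) F x t + z * value (a ∷ as) G x t ∎
      where
      H = combine y z F G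
      p = coeff F a
      q = coeff G a

    Feasible : List A → List Constraint → (A → Carrier) → Carrier → Set (c ⊔ ℓ₂ ⊔ a)
    Feasible as S x t = (∀ a → 0# ≤ x a) × All (λ F → 0# ≤ value as F x t) S

    -- A placeholder that always holds. It makes `single` and `pair` total, so that `eliminate` is
    -- built from a map and a Cartesian product.
    trivial : Constraint
    trivial = record { coeff = λ _ → 0# ; slope = 0# ; const = 0# }

    value-trivial : ∀ as x t → 0# ≤ value as trivial x t
    value-trivial as x t = +-nonNeg
      (∑-nonNeg as λ a → ≤-reflexive (≈-sym (zeroˡ (x a))))
      (+-nonNeg (≤-reflexive (≈-sym (zeroˡ t))) ≤-refl)

    single : A → Constraint → Constraint
    single a F with 0<⊎≤0 (coeff F a)
    ... | inj₁ _ = trivial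
    ... | inj₂ _ = F

    pair : A → Constraint → Constraint → Constraint
    pair a F G with 0<⊎≤0 (coeff F a) | 0<⊎≤0 (coeff G a)
    -- Both multipliers are nonnegative, and they are chosen so that the coefficients at `a` cancel.
    ... | inj₁ _ | inj₂ _ = combine (coeff F a) (- coeff G a) G F
    ... | _      | _      = trivial

    -- Fourier–Motzkin elimination of x(a); since x(a) ≥ 0 is always understood, a constraint
    -- with nonpositive coefficient at a also survives on its own.
    eliminate : A → List Constraint → List Constraint
    eliminate a S = List.map (single a) S ++ cartesianProductWith (pair a) S S

    value-∷ : ∀ a as F x t → value (a ∷ as) F x t ≈ coeff F a * x a + value as F x t
    value-∷ a as F x t = +-assoc (coeff F a * x a) _ _

    -- For `single`, the dropped term is nonpositive, so the remainder is at least the original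
    -- value. For `pair`, a nonnegative combination of two satisfied constraints is satisfied, and
    -- `x a` cancels from it.
    eliminate-sound : ∀ as {a S x t} → Feasible (a ∷ as) S x t → Feasible as (eliminate a S) x t
    eliminate-sound as {a} {S} {x} {t} (0≤x , sat) = 0≤x ,
      All.++⁺ (All.map⁺ (All.map single-sound sat))
              (All.cartesianProductWith⁺ (≡.setoid _) (≡.setoid _) (pair a) S S λ F∈ G∈ →
                pair-sound (All.lookup sat F∈) (All.lookup sat G∈))
      where
      single-sound : ∀ {F} → 0# ≤ value (a ∷ as) F x t → 0# ≤ value as (single a F) x t
      single-sound {F} 0≤F with 0<⊎≤0 (coeff F a)
      ... | inj₁ _   = value-trivial as x t
      ... | inj₂ p≤0 = begin
        0#                               ≤⟨ 0≤F ⟩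
        value (a ∷ as) F x t             ≈⟨ value-∷ a as F x t ⟩
        coeff F a * x a + value as F x t
          ≤⟨ +-monoˡ-≤ _ (≤-trans (≤-reflexive (*-comm _ _)) (x≤0⇒z*x≤0 (0≤x a) p≤0)) ⟩
        0# + value as F x t              ≈⟨ +-identityˡ _ ⟩
        value as F x t                   ∎

      pair-sound : ∀ {F G} → 0# ≤ value (a ∷ as) F x t → 0# ≤ value (a ∷ as) G x t →
                   0# ≤ value as (pair a F G) x t
      pair-sound {F} {G} 0≤F 0≤G with 0<⊎≤0 (coeff F a) | 0<⊎≤0 (coeff G a)
      ... | inj₂ _   | _        = value-trivial as x t
      ... | inj₁ _   | inj₁ _   = value-trivial as x t
      ... | inj₁ 0<p | inj₂ q≤0 = begin
        0#
          ≤⟨ +-nonNeg (*-nonNeg (proj₁ 0<p) 0≤G) (*-nonNeg (x≤0⇒0≤-x q≤0) 0≤F) ⟩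
        p * value (a ∷ as) G x t + - q * value (a ∷ as) F x t
          ≈⟨ +-cong (*-congˡ (value-∷ a as G x t)) (*-congˡ (value-∷ a as F x t)) ⟩
        p * (q * x a + value as G x t) + - q * (p * x a + value as F x t)
          ≈⟨ solve 6 (λ p q n x f g →
               p :* (q :* x :+ g) :+ n :* (p :* x :+ f) :=
               (q :+ n) :* (p :* x) :+ (p :* g :+ n :* f))
             ≈-refl p q (- q) (x a) (value as F x t) (value as G x t) ⟩
        (q - q) * (p * x a) + (p * value as G x t + - q * value as F x t)
          ≈⟨ +-congʳ (x≈0⇒x*y≈0 (-‿inverseʳ q)) ⟩
        0# + (p * value as G x t + - q * value as F x t)
          ≈⟨ +-identityˡ _ ⟩
        p * value as G x t + - q * value as F x t
          ≈⟨ value-combine as p (- q) G F x t ⟨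
        value as (combine p (- q) G F) x t ∎
        where
        p = coeff F a
        q = coeff G a

    -- Take for `v` the least value meeting all the lower bounds. A constraint `G` with coefficient
    -- at most 0 bounds `v` from above and is checked where `v` is tight: if `v` is 0, the surviving
    -- `single` constraint suffices; if `v` is the root of some `F`, the `pair` of `F` and `G` does.
    eliminate-complete : ∀ as {a S x t} → Feasible as (eliminate a S) x t →
                         ∃[ v ] 0# ≤ v × All (λ F → 0# ≤ coeff F a * v + value as F x t) S
    eliminate-complete as {a} {S} {x} {t} (0≤x , sat)
      with leastSolution (List.map (λ F → coeff F a , value as F x t) S)
    ... | v , 0≤v , pos , tight , _ = v , 0≤v , All.tabulate sat-v
      where
      sat-v : ∀ {F} → F ∈ S → 0# ≤ coeff F a * v + value as F x t
      -- The equations `eqG` and `eqF` are kept because `single` and `pair` branch on the same sign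
      -- tests and must be reduced later.
      sat-v {G} G∈ with 0<⊎≤0 (coeff G a) in eqG
      ... | inj₁ 0<q = All.lookup (All.map⁻ pos) G∈ 0<q
      ... | inj₂ q≤0 = nonpos tight
        where
        q = coeff G a
        single≡ : single a G ≡ G
        single≡ rewrite eqG = refl
        0≤G : 0# ≤ value as G x t
        0≤G = ≡.subst (λ H → 0# ≤ value as H x t) single≡
          (All.lookup sat (∈-++⁺ˡ (∈-map⁺ (single a) G∈)))
        nonpos : _ → 0# ≤ q * v + value as G x t
        nonpos (inj₁ v≈0) = begin
          0#                     ≤⟨ 0≤G ⟩
          value as G x t         ≈⟨ +-identityˡ _ ⟨
          0# + value as G x t    ≈⟨ +-congʳ (≈-trans (*-congˡ v≈0) (zeroʳ q)) ⟨
          q * v + value as G x t ∎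
        nonpos (inj₂ any) with find (Any.map⁻ any)
        ... | F , F∈ , 0<p , pv+f≈0 with 0<⊎≤0 (coeff F a) in eqF
        ...   | inj₂ p≤0 = contradiction p≤0 (<⇒≱ 0<p)
        -- Since `p * v + f` vanishes, `p` times the value of `G` at `v` equals the paired
        -- constraint, which is nonnegative.
        ...   | inj₁ _   = *-cancelˡ-≤ 0<p (begin
          p * 0#                                         ≈⟨ zeroʳ p ⟩
          0#                                             ≤⟨ 0≤pair ⟩
          value as (combine p (- q) G F) x t             ≈⟨ value-combine as p (- q) G F x t ⟩
          p * g + - q * f                                ≈⟨ +-identityˡ _ ⟨
          0# + (p * g + - q * f)
            ≈⟨ +-congʳ (x≈0⇒x*y≈0 (-‿inverseʳ q)) ⟨
          (q - q) * (p * v) + (p * g + - q * f)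
            ≈⟨ solve 6 (λ p q n v f g →
                 (q :+ n) :* (p :* v) :+ (p :* g :+ n :* f) :=
                 p :* (q :* v :+ g) :+ n :* (p :* v :+ f))
               ≈-refl p q (- q) v f g ⟩
          p * (q * v + g) + - q * (p * v + f)
            ≈⟨ +-congˡ (≈-trans (*-congˡ pv+f≈0) (zeroʳ _)) ⟩
          p * (q * v + g) + 0#                           ≈⟨ +-identityʳ _ ⟩
          p * (q * v + g)                                ∎)
          where
          p = coeff F a
          f = value as F x t
          g = value as G x t
          pair≡ : pair a F G ≡ combine p (- q) G F
          pair≡ rewrite eqF | eqG = refl
          0≤pair : 0# ≤ value as (combine p (- q) G F) x t
          0≤pair = ≡.subst (λ H → 0# ≤ value as H x t) pair≡
            (All.lookup sat (∈-++⁺ʳ (List.map (single a) S)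
              (∈-cartesianProductWith⁺ (pair a) F∈ G∈)))

    module _ (_≟ᴬ_ : DecidableEquality A) where

      update : (A → Carrier) → A → Carrier → A → Carrier
      update x a v b = if does (b ≟ᴬ a) then v else x b

      update-at : ∀ x a v → update x a v a ≡ v
      update-at x a v = ≡.cong (λ b → if b then v else x a) (dec-true (a ≟ᴬ a) refl)

      update-off : ∀ x {a b} v → b ≢ a → update x a v b ≡ x b
      update-off x {a} {b} v b≢a = ≡.cong (λ d → if d then v else x b) (dec-false (b ≟ᴬ a) b≢a)

      update-nonNeg : ∀ {x} a {v} → (∀ b → 0# ≤ x b) → 0# ≤ v → ∀ b → 0# ≤ update x a v b
      update-nonNeg a 0≤x 0≤v b with does (b ≟ᴬ a)
      ... | true  = 0≤v
      ... | false = 0≤x b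

      value-update : ∀ {a as} → All (a ≢_) as → ∀ F x v t →
                     value (a ∷ as) F (update x a v) t ≈ coeff F a * v + value as F x t
      value-update {a} {as} a∉ F x v t = ≈-trans (value-∷ a as F _ t)
        (+-cong (*-congˡ (≈-reflexive (update-at x a v)))
          (+-congʳ (∑-cong-∈ as λ b b∈ →
            *-congˡ (≈-reflexive (update-off x v (All.lookup a∉ b∈ ∘ ≡.sym))))))

      -- Eliminating every unknown in `as` leaves constraints on `t` alone, whose least solution is
      -- the minimum; the values of `x` are then recovered by back substitution. Soundness of
      -- elimination carries every competitor down with its `t′` unchanged, so minimality survives
      -- each step.
      minimise : ∀ {as} → Unique as → ∀ S {x₀ t₀} → 0# ≤ t₀ → Feasible as S x₀ t₀ →
                 ∃₂ λ x t → 0# ≤ t × Feasible as S x t ×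
                   (∀ x′ t′ → 0# ≤ t′ → Feasible as S x′ t′ → t ≤ t′)
      minimise {[]} [] S {x₀} {t₀} 0≤t₀ (0≤x₀ , sat₀)
        with leastSolution (List.map (λ F → slope F , const F) S)
      ... | t , 0≤t , pos , _ , least =
        x₀ , t , 0≤t , (0≤x₀ , All.tabulate sat) , least′
        where
        least′ : ∀ x′ t′ → 0# ≤ t′ → Feasible [] S x′ t′ → t ≤ t′
        least′ x′ t′ 0≤t′ (_ , sat′) =
          least t′ 0≤t′ (All.map⁺ (All.map (λ h → ≤-trans h (≤-reflexive (+-identityˡ _))) sat′))
        sat : ∀ {F} → F ∈ S → 0# ≤ 0# + (slope F * t + const F)
        sat {F} F∈ with 0<⊎≤0 (slope F)
        ... | inj₁ 0<d = ≤-trans (All.lookup (All.map⁻ pos) F∈ 0<d)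
          (≤-reflexive (≈-sym (+-identityˡ _)))
        -- An upper bound on `t` holds at the known feasible `t₀`, and `t ≤ t₀`; with nonpositive
        -- slope its value can only grow in passing from `t₀` to `t`.
        ... | inj₂ d≤0 = ≤-trans (All.lookup sat₀ F∈)
          (+-mono-≤ ≤-refl (+-monoˡ-≤ (const F)
            (*-antimonoˡ-≤ d≤0 (least′ x₀ t₀ 0≤t₀ (0≤x₀ , sat₀)))))
      minimise {a ∷ as} (a∉ ∷ u) S 0≤t₀ feasible₀
        with minimise u (eliminate a S) 0≤t₀ (eliminate-sound as feasible₀)
      ... | x , t , 0≤t , feasible@(0≤x , _) , least with eliminate-complete as feasible
      ...   | v , 0≤v , sat =
        update x a v , t , 0≤t ,
        ( update-nonNeg a 0≤x 0≤v
        , All.map (λ {F} h → ≤-trans h (≤-reflexive (≈-sym (value-update a∉ F x v t)))) sat) ,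
        λ x′ t′ 0≤t′ feasible′ → least x′ t′ 0≤t′ (eliminate-sound as feasible′)

-- Optimal densities and strategies by backward induction.

module Dynamic {c ℓ₁ ℓ₂} (ℝ : CompleteOrderedField c ℓ₁ ℓ₂) (m : ℕ) where

  open OrderedField ℝ m
  open LinearProgram ℝ m

  all𝓛-unique : Unique all𝓛
  all𝓛-unique = words-unique (Unique.allFin⁺ 2) m

  _≟𝓛_ : DecidableEquality 𝓛
  _≟𝓛_ = Vec.≡-dec Fin._≟_

  ⟪⟫-comm : ∀ x y → ⟪ x , y ⟫ ≈ ⟪ y , x ⟫
  ⟪⟫-comm x y = ∑-cong all𝓛 λ λ₁ → *-comm (x λ₁) (y λ₁)

  ⟪-⟫ : ∀ x y → ⟪ (λ λ₁ → - x λ₁) , y ⟫ ≈ - ⟪ x , y ⟫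
  ⟪-⟫ x y = begin-equality
    ⟪ (λ λ₁ → - x λ₁) , y ⟫
      ≈⟨ ∑-cong all𝓛 (λ λ₁ → ≈-trans (≈-sym (-‿distribˡ-* (x λ₁) (y λ₁))) (≈-sym (-1*x≈-x _))) ⟩
    ∑[ all𝓛 ] (λ λ₁ → - 1# * (x λ₁ * y λ₁)) ≈⟨ *-distribˡ-∑ all𝓛 (- 1#) _ ⟨
    - 1# * ⟪ x , y ⟫                        ≈⟨ -1*x≈-x _ ⟩
    - ⟪ x , y ⟫                             ∎

  module _ (b : Fin m → Carrier) where

    moments : Fin (suc m) → Carrier
    moments zero    = 1#
    moments (suc i) = b i

    P⇒moments : ∀ {x} → P b x → ∀ i → ⟪ ℓ i , x ⟫ ≈ moments i
    P⇒moments x∈P zero    = P.mass x∈P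
    P⇒moments x∈P (suc i) = P.moment x∈P i

    module _ (V : 𝓛 → Carrier) (0≤V : ∀ λ₁ → 0# ≤ V λ₁) where

      -- Each moment equation is encoded by two opposite inequalities, `atLeast` and `atMost`.
      atLeast : Fin (suc m) → Constraint
      atLeast i = record { coeff = ℓ i ; slope = 0# ; const = - moments i }

      atMost : Fin (suc m) → Constraint
      atMost i = record { coeff = λ λ₁ → - ℓ i λ₁ ; slope = 0# ; const = moments i }

      -- The epigraph condition `⟪ V , x ⟫ ≤ t`, which turns minimising a functional of `x` into
      -- minimising the unknown `t`.
      objective : Constraint
      objective = record { coeff = λ λ₁ → - V λ₁ ; slope = 1# ; const = 0# }

      value-atLeast : ∀ i x t → value all𝓛 (atLeast i) x t ≈ ⟪ ℓ i , x ⟫ - moments i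
      value-atLeast i x t = +-congˡ (≈-trans (+-congʳ (zeroˡ t)) (+-identityˡ _))

      value-atMost : ∀ i x t → value all𝓛 (atMost i) x t ≈ moments i - ⟪ ℓ i , x ⟫
      value-atMost i x t = ≈-trans
        (+-cong (⟪-⟫ (ℓ i) x) (≈-trans (+-congʳ (zeroˡ t)) (+-identityˡ _))) (+-comm _ _)

      value-objective : ∀ x t → value all𝓛 objective x t ≈ t - ⟪ V , x ⟫
      value-objective x t = ≈-trans
        (+-cong (⟪-⟫ V x) (≈-trans (+-identityʳ _) (*-identityˡ t))) (+-comm _ _)

      program : List Constraint
      program = objective ∷ List.map atLeast (allFin (suc m)) ++ List.map atMost (allFin (suc m))

      P⇒feasible : ∀ {x} → P b x → Feasible all𝓛 program x ⟪ V , x ⟫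
      P⇒feasible {x} x∈P = P.nonNeg x∈P ,
        ≤-trans (x≤y⇒0≤y-x ≤-refl) (≤-reflexive (≈-sym (value-objective x _))) ∷
        All.++⁺
          (All.map⁺ {xs = allFin (suc m)} (All.tabulate λ {i} _ → ≤-trans
            (x≤y⇒0≤y-x (≤-reflexive (≈-sym (P⇒moments x∈P i))))
            (≤-reflexive (≈-sym (value-atLeast i x _)))))
          (All.map⁺ {xs = allFin (suc m)} (All.tabulate λ {i} _ → ≤-trans
            (x≤y⇒0≤y-x (≤-reflexive (P⇒moments x∈P i)))
            (≤-reflexive (≈-sym (value-atMost i x _)))))

      feasible⇒P : ∀ {x t} → Feasible all𝓛 program x t → P b x × ⟪ V , x ⟫ ≤ t
      feasible⇒P {x} {t} (0≤x , 0≤obj ∷ sat) =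
        record { nonNeg = 0≤x ; mass = eq zero ; moment = eq ∘ suc } ,
        0≤y-x⇒x≤y (≤-trans 0≤obj (≤-reflexive (value-objective x t)))
        where
        eq : ∀ i → ⟪ ℓ i , x ⟫ ≈ moments i
        eq i = ≤-antisym
          (0≤y-x⇒x≤y (≤-trans
            (All.lookup (All.map⁻ (All.++⁻ʳ (List.map atLeast (allFin (suc m))) sat)) (∈-allFin i))
            (≤-reflexive (value-atMost i x t))))
          (0≤y-x⇒x≤y (≤-trans
            (All.lookup (All.map⁻ (All.++⁻ˡ (List.map atLeast (allFin (suc m))) sat)) (∈-allFin i))
            (≤-reflexive (value-atLeast i x t))))

      0≤objective : ∀ {x} → P b x → 0# ≤ ⟪ V , x ⟫
      0≤objective x∈P = ∑-nonNeg all𝓛 λ λ₁ → *-nonNeg (0≤V λ₁) (P.nonNeg x∈P λ₁)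

      -- Each density `x′` is feasible with `t′` equal to its own objective, so the minimal `t` lies
      -- below all objectives, while the objective of the minimiser is at most `t`. Nonnegativity of
      -- `V` keeps these `t′` in the range `0# ≤ t′` of `minimise`.
      minimalDensity : ∃ (P b) → ∃[ x ] P b x × (∀ {x′} → P b x′ → ⟪ x , V ⟫ ≤ ⟪ x′ , V ⟫)
      minimalDensity (x₀ , x₀∈P)
        with minimise _≟𝓛_ all𝓛-unique program (0≤objective x₀∈P) (P⇒feasible x₀∈P)
      ... | x , t , _ , feasible , least with feasible⇒P feasible
      ...   | x∈P , Vx≤t = x , x∈P , λ {x′} x′∈P → begin
        ⟪ x , V ⟫  ≈⟨ ⟪⟫-comm x V ⟩
        ⟪ V , x ⟫  ≤⟨ Vx≤t ⟩
        t          ≤⟨ least x′ ⟪ V , x′ ⟫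
                       (0≤objective x′∈P) (P⇒feasible x′∈P) ⟩
        ⟪ V , x′ ⟫ ≈⟨ ⟪⟫-comm V x′ ⟩
        ⟪ x′ , V ⟫ ∎

  module _ {b : Fin m → Carrier} where

    Strategy : ℕ → Set _
    Strategy n = 𝓣* n → ∃ (P b)

    first : ∀ {n} → Strategy (suc n) → ∃ (P b)
    first Φ = Φ (zero , [])

    after : ∀ {n} → Strategy (suc n) → 𝓛 → Strategy n
    after Φ λ₁ (k , w) = Φ (suc k , λ₁ ∷ w)

    prepend : ∀ {n} → ∃ (P b) → (𝓛 → Strategy n) → Strategy (suc n)
    prepend x Ψ (zero  , [])     = x
    prepend x Ψ (suc k , λ₁ ∷ w) = Ψ λ₁ (k , w)

    pathDensity-∷ : ∀ {n} (Φ : Strategy (suc n)) λ₁ w →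
                    pathDensity Φ (λ₁ ∷ w) ≈ proj₁ (first Φ) λ₁ * pathDensity (after Φ λ₁) w
    pathDensity-∷ Φ λ₁ w = *-congˡ (product-cong λ k → ≈-reflexive
      (≡.cong (λ v → proj₁ (Φ (suc k , v)) (lookup w k))
        -- The two prefixes differ only in the proof that their length is within bounds.
        (Vec.truncate-irrelevant (Fin.toℕ≤n (suc k)) (s≤s (Fin.toℕ≤n k)) (λ₁ ∷ w))))

    pathDensity-nonNeg : ∀ {n} (Φ : Strategy n) w → 0# ≤ pathDensity Φ w
    pathDensity-nonNeg Φ w = product-nonNeg λ k → P.nonNeg (proj₂ (Φ _)) (lookup w k)

    -- The tower property: condition on the first letter.
    𝔼-∷ : ∀ {n} (Φ : Strategy (suc n)) F →
          𝔼 (pathDensity Φ) F ≈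
          ∑[ all𝓛 ] λ λ₁ → proj₁ (first Φ) λ₁ * 𝔼 (pathDensity (after Φ λ₁)) (F ∘ (λ₁ ∷_))
    𝔼-∷ {n} Φ F = ≈-trans (∑-cartesianProductWith _∷_ all𝓛 (words all𝓛 n) _)
      (∑-cong all𝓛 λ λ₁ → ≈-trans
        (∑-cong (words all𝓛 n) λ w → ≈-trans (*-congʳ (pathDensity-∷ Φ λ₁ w)) (*-assoc _ _ _))
        (≈-sym (*-distribˡ-∑ (words all𝓛 n) _ _)))

    𝔼-mono-≤ : ∀ {n} (Φ : Strategy n) {F G} → (∀ w → F w ≤ G w) →
               𝔼 (pathDensity Φ) F ≤ 𝔼 (pathDensity Φ) G
    𝔼-mono-≤ {n} Φ F≤G = ∑-mono-≤ (words all𝓛 n) λ w → *-monoˡ-≤ (pathDensity-nonNeg Φ w) (F≤G w)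

    -- The continuation may depend on the first letter, so all continuations can be made optimal
    -- independently. With `V` the resulting optimal values, the first density only has to minimise
    -- the linear functional given by `V`.
    minimalStrategy : ∃ (P b) → ∀ {n} (F : Vec 𝓛 n → Carrier) → (∀ w → 0# ≤ F w) →
                      ∃[ Φ ] ∀ Φ′ → 𝔼 (pathDensity {b} Φ) F ≤ 𝔼 (pathDensity {b} Φ′) F
    minimalStrategy x₀ {zero}  F 0≤F = (λ ()) , λ _ → ≤-refl
    minimalStrategy x₀ {suc n} F 0≤F = Φ , λ Φ′ → begin
      𝔼 (pathDensity Φ) F
        ≈⟨ 𝔼-∷ Φ F ⟩
      ⟪ x , V ⟫
        ≤⟨ x-minimal (proj₂ (first Φ′)) ⟩
      ⟪ proj₁ (first Φ′) , V ⟫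
        ≤⟨ ∑-mono-≤ all𝓛 (λ λ₁ → *-monoˡ-≤ (P.nonNeg (proj₂ (first Φ′)) λ₁)
             (proj₂ (rest λ₁) (after Φ′ λ₁))) ⟩
      ∑[ all𝓛 ] (λ λ₁ → proj₁ (first Φ′) λ₁ * 𝔼 (pathDensity (after Φ′ λ₁)) (F ∘ (λ₁ ∷_)))
        ≈⟨ 𝔼-∷ Φ′ F ⟨
      𝔼 (pathDensity Φ′) F ∎
      where
      rest : ∀ λ₁ → ∃[ Ψ ] ∀ Ψ′ → 𝔼 (pathDensity {b} Ψ) (F ∘ (λ₁ ∷_)) ≤
                                   𝔼 (pathDensity {b} Ψ′) (F ∘ (λ₁ ∷_))
      rest λ₁ = minimalStrategy x₀ (F ∘ (λ₁ ∷_)) (0≤F ∘ (λ₁ ∷_))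
      V : 𝓛 → Carrier
      V λ₁ = 𝔼 (pathDensity (proj₁ (rest λ₁))) (F ∘ (λ₁ ∷_))
      minimal = minimalDensity b V (λ λ₁ → ∑-nonNeg (words all𝓛 n) λ w →
        *-nonNeg (pathDensity-nonNeg (proj₁ (rest λ₁)) w) (0≤F (λ₁ ∷ w))) x₀
      x = proj₁ minimal
      x-minimal = proj₂ (proj₂ minimal)
      Φ : Strategy (suc n)
      Φ = prepend (x , proj₁ (proj₂ minimal)) (proj₁ ∘ rest)

-- The lower bound: superadditivity and regrouping of products.

module LowerBound {c ℓ₁ ℓ₂} (ℝ : CompleteOrderedField c ℓ₁ ℓ₂) (m : ℕ) where

  open OrderedField ℝ m
  open Dynamic ℝ m

  2# : Carrier
  2# = 1# + 1#

  0<2 : 0# < 2#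
  0<2 = +-nonNeg 0≤1 0≤1 , λ 0≈2 → 0≉1 (≤-antisym 0≤1 (begin
    1#      ≈⟨ +-identityˡ 1# ⟨
    0# + 1# ≤⟨ +-monoˡ-≤ 1# 0≤1 ⟩
    2#      ≈⟨ 0≈2 ⟨
    0#      ∎))

  sumFin-∑-comm : ∀ {n a} {A : Set a} (xs : List A) (f : Fin n → A → Carrier) →
                  sumFin (λ j → ∑[ xs ] (f j)) ≈ ∑[ xs ] λ x → sumFin λ j → f j x
  sumFin-∑-comm {n} xs f = begin-equality
    sumFin (λ j → ∑[ xs ] (f j))                  ≈⟨ ∑-allFin {n} (λ j → ∑[ xs ] (f j)) ⟨
    ∑[ allFin n ] (λ j → ∑[ xs ] (f j))           ≈⟨ ∑-comm (allFin n) xs f ⟩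
    ∑[ xs ] (λ x → ∑[ allFin n ] λ j → f j x)     ≈⟨ ∑-cong xs (λ x → ∑-allFin {n} (λ j → f j x)) ⟩
    ∑[ xs ] (λ x → sumFin λ j → f j x)            ∎

  sumFin-zero : ∀ {n} {f : Fin n → Carrier} → (∀ i → f i ≈ 0#) → sumFin f ≈ 0#
  sumFin-zero {zero}  f≈0 = ≈-refl
  sumFin-zero {suc n} f≈0 = ≈-trans (+-cong (f≈0 zero) (sumFin-zero (f≈0 ∘ suc))) (+-identityˡ 0#)

  sumFin-single : ∀ {n} {f : Fin n → Carrier} i → (∀ j → j ≢ i → f j ≈ 0#) → sumFin f ≈ f i
  sumFin-single zero    f≈0 = ≈-trans (+-congˡ (sumFin-zero λ j → f≈0 (suc j) λ ())) (+-identityʳ _)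
  sumFin-single (suc i) f≈0 = ≈-trans
    (+-cong (f≈0 zero λ ()) (sumFin-single i λ j j≢i → f≈0 (suc j) (j≢i ∘ Fin.suc-injective)))
    (+-identityˡ _)

  product-counts : ∀ {p n} (g : Fin p → Carrier) (I : Vec (Fin p) n) →
                   product (λ i → g i ^ lookup (counts I) i) ≈ product (λ k → g (lookup I k))
  product-counts g []      = product-zeros g
    where
    product-zeros : ∀ {p} (g : Fin p → Carrier) →
                    product (λ i → g i ^ lookup (Vec.replicate p 0) i) ≈ 1#
    product-zeros {zero}  g = ≈-refl
    product-zeros {suc p} g = ≈-trans (*-identityˡ _) (product-zeros (g ∘ suc))
  product-counts g (i ∷ I) = ≈-trans (product-suc g (counts I) i) (*-congˡ (product-counts g I))
    where
    product-suc : ∀ {p} (g : Fin p → Carrier) k i →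
                  product (λ j → g j ^ lookup (updateAt k i suc) j) ≈
                  g i * product (λ j → g j ^ lookup k j)
    product-suc g (x ∷ k) zero    = *-assoc _ _ _
    product-suc g (x ∷ k) (suc i) = ≈-trans (*-congˡ (product-suc (g ∘ suc) k i))
      (solve 3 (λ a b d → a :* (b :* d) := b :* (a :* d)) ≈-refl _ _ _)

  -- If one summand is at most `z`, its positive part vanishes and monotonicity suffices. If both
  -- exceed `z`, the left side subtracts `z` twice and the right side once, with `z` nonnegative.
  ⁺-superadditive : ∀ {x y z} → 0# ≤ x → 0# ≤ y → 0# ≤ z → (x - z) ⁺ + (y - z) ⁺ ≤ (x + y - z) ⁺
  ⁺-superadditive {x} {y} {z} 0≤x 0≤y 0≤z with total x z | total y z
  ... | inj₁ x≤z | _ = begin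
    (x - z) ⁺ + (y - z) ⁺ ≈⟨ +-congʳ (x≤0⇒x⁺≈0 (x≤y⇒x-y≤0 x≤z)) ⟩
    0# + (y - z) ⁺        ≈⟨ +-identityˡ _ ⟩
    (y - z) ⁺             ≤⟨ ⁺-mono-≤ (+-monoˡ-≤ (- z) (y≤x+y 0≤x)) ⟩
    (x + y - z) ⁺         ∎
  ... | inj₂ z≤x | inj₁ y≤z = begin
    (x - z) ⁺ + (y - z) ⁺ ≈⟨ +-congˡ (x≤0⇒x⁺≈0 (x≤y⇒x-y≤0 y≤z)) ⟩
    (x - z) ⁺ + 0#        ≈⟨ +-identityʳ _ ⟩
    (x - z) ⁺             ≤⟨ ⁺-mono-≤ (+-monoˡ-≤ (- z) (x≤x+y 0≤y)) ⟩
    (x + y - z) ⁺         ∎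
  ... | inj₂ z≤x | inj₂ z≤y = begin
    (x - z) ⁺ + (y - z) ⁺ ≈⟨ +-cong (0≤x⇒x⁺≈x (x≤y⇒0≤y-x z≤x)) (0≤x⇒x⁺≈x (x≤y⇒0≤y-x z≤y)) ⟩
    (x - z) + (y - z)     ≤⟨ +-monoˡ-≤ (y - z) x-z≤x ⟩
    x + (y - z)           ≈⟨ +-assoc x y (- z) ⟨
    x + y - z             ≤⟨ x≤x⊔y _ 0# ⟩
    (x + y - z) ⁺         ∎
    where
    x-z≤x : x - z ≤ x
    x-z≤x = ≤-trans (x≤x+y 0≤z) (≤-reflexive (x-y+y≈x x z))

  -- Terms with `ε x` equal to 0 drop out on both sides; the others are absorbed one at a time by
  -- the two-term inequality.
  ⁺-superadditive-∑ : ∀ {a} {A : Set a} (xs : List A) {ε f : A → Carrier} {z} →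
    (∀ x → ε x ≈ 0# ⊎ ε x ≈ 1#) → (∀ x → 0# ≤ f x) → 0# ≤ z →
    ∑[ xs ] (λ x → ε x * (f x - z) ⁺) ≤ (∑[ xs ] (λ x → ε x * f x) - z) ⁺
  ⁺-superadditive-∑ []       ε01 0≤f 0≤z = 0≤x⁺ _
  ⁺-superadditive-∑ (x ∷ xs) {ε} {f} {z} ε01 0≤f 0≤z with ε01 x
  ... | inj₁ ε≈0 = begin
    ε x * (f x - z) ⁺ + rest          ≈⟨ +-congʳ (x≈0⇒x*y≈0 ε≈0) ⟩
    0# + rest                         ≈⟨ +-identityˡ _ ⟩
    rest                              ≤⟨ ⁺-superadditive-∑ xs ε01 0≤f 0≤z ⟩
    (∑εf - z) ⁺                       ≈⟨ ⁺-cong (+-congʳ (+-identityˡ _)) ⟨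
    (0# + ∑εf - z) ⁺                  ≈⟨ ⁺-cong (+-congʳ (+-congʳ (x≈0⇒x*y≈0 ε≈0))) ⟨
    (ε x * f x + ∑εf - z) ⁺           ∎
    where
    rest = ∑[ xs ] λ x → ε x * (f x - z) ⁺
    ∑εf = ∑[ xs ] λ x → ε x * f x
  ... | inj₂ ε≈1 = begin
    ε x * (f x - z) ⁺ + rest          ≈⟨ +-congʳ (x≈1⇒x*y≈y ε≈1) ⟩
    (f x - z) ⁺ + rest                ≤⟨ +-mono-≤ ≤-refl (⁺-superadditive-∑ xs ε01 0≤f 0≤z) ⟩
    (f x - z) ⁺ + (∑εf - z) ⁺         ≤⟨ ⁺-superadditive (0≤f x) (∑-nonNeg xs 0≤εf) 0≤z ⟩
    (f x + ∑εf - z) ⁺                 ≈⟨ ⁺-cong (+-congʳ (+-congʳ (x≈1⇒x*y≈y ε≈1))) ⟨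
    (ε x * f x + ∑εf - z) ⁺           ∎
    where
    rest = ∑[ xs ] λ x → ε x * (f x - z) ⁺
    ∑εf = ∑[ xs ] λ x → ε x * f x
    0≤εf : ∀ y → 0# ≤ ε y * f y
    0≤εf y with ε01 y
    ... | inj₁ ε≈0 = ≤-reflexive (≈-sym (x≈0⇒x*y≈0 ε≈0))
    ... | inj₂ ε≈1 = ≤-trans (0≤f y) (≤-reflexive (≈-sym (x≈1⇒x*y≈y ε≈1)))

  -- Indicators `up` and the expansion of an ℓ-positive vector in them.

  isZero : Fin 2 → Carrier
  isZero zero    = 1#
  isZero (suc _) = 0#

  -- The indicator of λ(i) = 0, so that ℓ i = 2 (up i) − 1 for i ≥ 1 and up 0 = 1.
  up : Fin (suc m) → 𝓛 → Carrier
  up i λ₁ = isZero (λ₁ ⟨ i ⟩)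

  ℓ+1≈2up : ∀ i λ₁ → ℓ (suc i) λ₁ + 1# ≈ 2# * up (suc i) λ₁
  ℓ+1≈2up i λ₁ with lookup λ₁ i
  ... | zero     = ≈-sym (*-identityʳ 2#)
  ... | suc zero = ≈-trans (+-congʳ (*-identityʳ (- 1#)))
    (≈-trans (-‿inverseˡ 1#) (≈-sym (zeroʳ 2#)))

  -- For positive indices, integrate `ℓ + 1 = 2 up` against `x`: the moment and mass conditions give
  -- `1# + b i`, which is then halved.
  mean-up : ∀ {b x} → P b x → ∀ i → ⟪ x , up i ⟫ ≈ β b i
  mean-up {b} {x} x∈P zero    = ≈-trans (⟪⟫-comm x (up zero)) (P.mass x∈P)
  mean-up {b} {x} x∈P (suc i) = begin-equality
    E                 ≈⟨ x⁻¹*[x*y]≈y E 0<2 ⟨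
    2# ⁻¹ * (2# * E)  ≈⟨ *-comm _ _ ⟩
    2# * E * 2# ⁻¹    ≈⟨ *-congʳ 2E≈1+b ⟩
    β b (suc i)       ∎
    where
    E = ⟪ x , up (suc i) ⟫
    2E≈1+b : 2# * E ≈ 1# + b i
    2E≈1+b = begin-equality
      2# * E
        ≈⟨ *-distribˡ-∑ all𝓛 2# _ ⟩
      ∑[ all𝓛 ] (λ λ₁ → 2# * (x λ₁ * up (suc i) λ₁))
        ≈⟨ ∑-cong all𝓛 (λ λ₁ → begin-equality
             2# * (x λ₁ * up (suc i) λ₁)
               ≈⟨ solve 3 (λ t x e → t :* (x :* e) := t :* e :* x) ≈-refl
                    2# (x λ₁) (up (suc i) λ₁) ⟩
             2# * up (suc i) λ₁ * x λ₁        ≈⟨ *-congʳ (ℓ+1≈2up i λ₁) ⟨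
             (ℓ (suc i) λ₁ + 1#) * x λ₁       ≈⟨ distribʳ (x λ₁) _ _ ⟩
             ℓ (suc i) λ₁ * x λ₁ + 1# * x λ₁  ∎) ⟩
      ∑[ all𝓛 ] (λ λ₁ → ℓ (suc i) λ₁ * x λ₁ + 1# * x λ₁)
        ≈⟨ ∑-distrib-+ all𝓛 _ _ ⟩
      ⟪ ℓ (suc i) , x ⟫ + ⟪ ℓ zero , x ⟫
        ≈⟨ +-cong (P.moment x∈P i) (P.mass x∈P) ⟩
      b i + 1#
        ≈⟨ +-comm _ _ ⟩
      1# + b i ∎

  up-ν₀ : ∀ i → up (suc i) (ν zero) ≈ 0#
  up-ν₀ i = ≈-reflexive (≡.cong isZero (Vec.lookup∘tabulate (λ _ → suc zero) i))

  lookup-ν : ∀ i j → lookup (ν (suc i)) j ≡ (if does (i Fin.≟ j) then zero else suc zero)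
  lookup-ν i j = Vec.lookup∘tabulate _ j

  up-ν-≡ : ∀ i → up (suc i) (ν (suc i)) ≈ 1#
  up-ν-≡ i = ≈-reflexive (≡.trans (≡.cong isZero (lookup-ν i i))
    (≡.cong (λ d → isZero (if d then zero else suc zero)) (dec-true (i Fin.≟ i) refl)))

  up-ν-≢ : ∀ i j → j ≢ i → up (suc j) (ν (suc i)) ≈ 0#
  up-ν-≢ i j j≢i = ≈-reflexive (≡.trans (≡.cong isZero (lookup-ν i j))
    (≡.cong (λ d → isZero (if d then zero else suc zero)) (dec-false (i Fin.≟ j) (j≢i ∘ ≡.sym))))

  module _ {v : 𝓛 → Carrier} (v-pos : ℓ-Positive v) where

    open ℓ-Positive v-pos

    ∑a : Carrier
    ∑a = sumFin (a ∘ suc)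

    -- Substitute `ℓ = 2 up - 1` for the positive indices. The constant `∑a` is moved to the left so
    -- that no subtraction occurs.
    expand-up : ∀ λ₁ → v λ₁ + ∑a ≈ a zero + sumFin (λ i → 2# * a (suc i) * up (suc i) λ₁)
    expand-up λ₁ = begin-equality
      v λ₁ + ∑a
        ≈⟨ +-congʳ (≈-trans (expand λ₁) (+-congʳ (*-identityʳ (a zero)))) ⟩
      a zero + sumFin (λ i → a (suc i) * ℓ (suc i) λ₁) + ∑a
        ≈⟨ +-assoc _ _ _ ⟩
      a zero + (sumFin (λ i → a (suc i) * ℓ (suc i) λ₁) + ∑a)
        ≈⟨ +-congˡ (sum-distrib-+ (λ i → a (suc i) * ℓ (suc i) λ₁) (a ∘ suc)) ⟨
      a zero + sumFin (λ i → a (suc i) * ℓ (suc i) λ₁ + a (suc i))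
        ≈⟨ +-congˡ (sum-cong-≋ λ i → begin-equality
             a (suc i) * ℓ (suc i) λ₁ + a (suc i)
               ≈⟨ solve 2 (λ a l → a :* l :+ a := a :* (l :+ con 1)) ≈-refl
                    (a (suc i)) (ℓ (suc i) λ₁) ⟩
             a (suc i) * (ℓ (suc i) λ₁ + 1#)        ≈⟨ *-congˡ (ℓ+1≈2up i λ₁) ⟩
             a (suc i) * (2# * up (suc i) λ₁)
               ≈⟨ solve 3 (λ a t e → a :* (t :* e) := t :* a :* e) ≈-refl
                    (a (suc i)) 2# (up (suc i) λ₁) ⟩
             2# * a (suc i) * up (suc i) λ₁         ∎) ⟩
      a zero + sumFin (λ i → 2# * a (suc i) * up (suc i) λ₁) ∎

    v-ν₀ : v (ν zero) + ∑a ≈ a zero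
    v-ν₀ = begin-equality
      v (ν zero) + ∑a
        ≈⟨ expand-up (ν zero) ⟩
      a zero + sumFin (λ i → 2# * a (suc i) * up (suc i) (ν zero))
        ≈⟨ +-congˡ (sumFin-zero λ i → ≈-trans (*-congˡ (up-ν₀ i)) (zeroʳ _)) ⟩
      a zero + 0#
        ≈⟨ +-identityʳ _ ⟩
      a zero ∎

    v-ν : ∀ i → v (ν (suc i)) + ∑a ≈ a zero + 2# * a (suc i)
    v-ν i = ≈-trans (expand-up (ν (suc i))) (+-congˡ (≈-trans
      (sumFin-single i λ j j≢i → ≈-trans (*-congˡ (up-ν-≢ i j j≢i)) (zeroʳ _))
      (≈-trans (*-congˡ (up-ν-≡ i)) (*-identityʳ _))))

    -- Compare `expand-up` at two points: at `ν (suc i)` only the indicator of index `suc i`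
    -- survives among the positive indices, at `ν zero` none does.
    α-suc : ∀ i → α v (suc i) ≈ 2# * a (suc i)
    α-suc i = begin-equality
      v (ν (suc i)) - v (ν zero)
        ≈⟨ +-congʳ (+-cancelʳ _ _ _ (begin-equality
             v (ν (suc i)) + ∑a                    ≈⟨ v-ν i ⟩
             a zero + 2# * a (suc i)               ≈⟨ +-congʳ v-ν₀ ⟨
             v (ν zero) + ∑a + 2# * a (suc i)
               ≈⟨ solve 3 (λ v s t → v :+ s :+ t := t :+ v :+ s) ≈-refl
                    (v (ν zero)) ∑a (2# * a (suc i)) ⟩
             2# * a (suc i) + v (ν zero) + ∑a      ∎)) ⟩
      2# * a (suc i) + v (ν zero) - v (ν zero)
        ≈⟨ x+y-y≈x _ _ ⟩
      2# * a (suc i) ∎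

    expand-α : ∀ λ₁ → v λ₁ ≈ sumFin (λ i → α v i * up i λ₁)
    expand-α λ₁ = +-cancelʳ _ _ _ (begin-equality
      v λ₁ + ∑a
        ≈⟨ expand-up λ₁ ⟩
      a zero + sumFin (λ i → 2# * a (suc i) * up (suc i) λ₁)
        ≈⟨ +-cong v-ν₀ (sum-cong-≋ λ i → *-congʳ (α-suc i)) ⟨
      v (ν zero) + ∑a + sumFin (λ i → α v (suc i) * up (suc i) λ₁)
        ≈⟨ solve 3 (λ v s t → v :+ s :+ t := v :* con 1 :+ t :+ s) ≈-refl
             (v (ν zero)) ∑a (sumFin (λ i → α v (suc i) * up (suc i) λ₁)) ⟩
      v (ν zero) * 1# + sumFin (λ i → α v (suc i) * up (suc i) λ₁) + ∑a ∎)

    -- `α v zero` is a value of `v`, which equals its positive part; the other coefficients are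
    -- `2# * a (suc i)`, and ℓ-positivity applies.
    α-nonNeg : (∀ λ₁ → v λ₁ ≈ v λ₁ ⁺) → ∀ i → 0# ≤ α v i
    α-nonNeg v≈v⁺ zero    = ≤-trans (0≤x⁺ _) (≤-reflexive (≈-sym (v≈v⁺ (ν zero))))
    α-nonNeg v≈v⁺ (suc i) = ≤-trans (*-nonNeg (proj₁ 0<2) (proj₁ (positive i)))
      (≤-reflexive (≈-sym (α-suc i)))

  -- Expansion over words of indices and comparison of expectations.

  indices : ∀ n → List (Vec (Fin (suc m)) n)
  indices = words (allFin (suc m))

  ups : ∀ {n} → Vec (Fin (suc m)) n → Vec 𝓛 n → Carrier
  ups I w = product λ k → up (lookup I k) (lookup w k)

  along : ∀ {n} → (Fin (suc m) → Carrier) → Vec (Fin (suc m)) n → Carrier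
  along g I = product λ k → g (lookup I k)

  ups-0∨1 : ∀ {n} (I : Vec (Fin (suc m)) n) w → ups I w ≈ 0# ⊎ ups I w ≈ 1#
  ups-0∨1 []      []       = inj₂ ≈-refl
  ups-0∨1 (i ∷ I) (λ₁ ∷ w) with λ₁ ⟨ i ⟩ | ups-0∨1 I w
  ... | suc _ | _          = inj₁ (zeroˡ _)
  ... | zero  | inj₁ ups≈0 = inj₁ (≈-trans (*-identityˡ _) ups≈0)
  ... | zero  | inj₂ ups≈1 = inj₂ (≈-trans (*-identityˡ _) ups≈1)

  -- Multiply out the product over positions, each factor being a sum over `0, …, m` by `expand-α`;
  -- a choice of one term per factor is an index word `I`.
  product-expand : ∀ {v} → ℓ-Positive v → ∀ {n} (w : Vec 𝓛 n) →
                   product (λ k → v (lookup w k)) ≈ ∑[ indices n ] λ I → ups I w * along (α v) I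
  product-expand v-pos []       = ≈-sym (≈-trans (+-identityʳ _) (*-identityˡ 1#))
  product-expand {v} v-pos {suc n} (λ₁ ∷ w) = begin-equality
    v λ₁ * product (λ k → v (lookup w k))
      ≈⟨ *-cong (≈-trans (expand-α v-pos λ₁) (≈-sym (∑-allFin {suc m} (λ i → α v i * up i λ₁))))
           (product-expand v-pos w) ⟩
    ∑[ allFin (suc m) ] (λ i → α v i * up i λ₁) * R
      ≈⟨ *-distribʳ-∑ (allFin (suc m)) R _ ⟩
    ∑[ allFin (suc m) ] (λ i → α v i * up i λ₁ * R)
      ≈⟨ ∑-cong (allFin (suc m)) (λ i → ≈-trans (*-distribˡ-∑ (indices n) _ _)
           (∑-cong (indices n) λ I →
             solve 4 (λ a u x y → a :* u :* (x :* y) := u :* x :* (a :* y)) ≈-refl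
               (α v i) (up i λ₁) (ups I w) (along (α v) I))) ⟩
    ∑[ allFin (suc m) ] (λ i → ∑[ indices n ] λ I → ups (i ∷ I) (λ₁ ∷ w) * along (α v) (i ∷ I))
      ≈⟨ ∑-cartesianProductWith _∷_ (allFin (suc m)) (indices n) _ ⟨
    ∑[ indices (suc n) ] (λ I → ups I (λ₁ ∷ w) * along (α v) I) ∎
    where
    R = ∑[ indices n ] λ I → ups I w * along (α v) I

  -- The strategy may depend on the past, but every density in `P b` gives `up i` the same mean. So
  -- the conditional expectation of each factor is a constant, and the expectation factorises for
  -- any strategy.
  𝔼-ups : ∀ {b n} (Φ : Strategy {b} n) I → 𝔼 (pathDensity Φ) (ups I) ≈ along (β b) I
  𝔼-ups {b} {zero}  Φ []      = ≈-trans (+-identityʳ _) (*-identityˡ 1#)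
  𝔼-ups {b} {suc n} Φ (i ∷ I) = begin-equality
    𝔼 (pathDensity Φ) (ups (i ∷ I))
      ≈⟨ 𝔼-∷ Φ _ ⟩
    ∑[ all𝓛 ] (λ λ₁ → x λ₁ * 𝔼 (pathDensity (after Φ λ₁)) (λ w → up i λ₁ * ups I w))
      ≈⟨ ∑-cong all𝓛 (λ λ₁ → ≈-trans (*-congˡ (begin-equality
           ∑[ words all𝓛 n ] (λ w → pathDensity (after Φ λ₁) w * (up i λ₁ * ups I w))
             ≈⟨ ∑-cong (words all𝓛 n) (λ w →
                  solve 3 (λ p u x → p :* (u :* x) := u :* (p :* x)) ≈-refl
                    (pathDensity (after Φ λ₁) w) (up i λ₁) (ups I w)) ⟩
           ∑[ words all𝓛 n ] (λ w → up i λ₁ * (pathDensity (after Φ λ₁) w * ups I w))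
             ≈⟨ *-distribˡ-∑ (words all𝓛 n) _ _ ⟨
           up i λ₁ * 𝔼 (pathDensity (after Φ λ₁)) (ups I)
             ≈⟨ *-congˡ (𝔼-ups (after Φ λ₁) I) ⟩
           up i λ₁ * along (β b) I ∎))
         (≈-sym (*-assoc _ _ _))) ⟩
    ∑[ all𝓛 ] (λ λ₁ → x λ₁ * up i λ₁ * along (β b) I)
      ≈⟨ *-distribʳ-∑ all𝓛 (along (β b) I) _ ⟨
    ⟪ x , up i ⟫ * along (β b) I
      ≈⟨ *-congʳ (mean-up (proj₂ (first Φ)) i) ⟩
    β b i * along (β b) I ∎
    where
    x = proj₁ (first Φ)

  module _ {r} (u : Fin r → 𝓛 → Carrier) (u-pos : ∀ j → ℓ-Positive (u j))
           (u≈u⁺ : ∀ j λ₁ → u j λ₁ ≈ u j λ₁ ⁺)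
           (s : Fin r → Carrier) (C : Carrier) (0≤s : ∀ j → 0# ≤ s j) (0≤C : 0# ≤ C) where

    weight : ∀ {n} → Vec (Fin (suc m)) n → Carrier
    weight I = sumFin λ j → s j * along (α (u j)) I

    weight-nonNeg : ∀ {n} (I : Vec (Fin (suc m)) n) → 0# ≤ weight I
    weight-nonNeg I = sumFin-nonNeg λ j → *-nonNeg (0≤s j)
      (product-nonNeg λ k → α-nonNeg (u-pos j) (u≈u⁺ j) (lookup I k))

    payoff-expand : ∀ {n} (w : Vec 𝓛 n) →
      sumFin (λ j → s j * product λ k → u j (lookup w k)) ≈ ∑[ indices n ] λ I → ups I w * weight I
    payoff-expand {n} w = begin-equality
      sumFin (λ j → s j * product λ k → u j (lookup w k))
        ≈⟨ sum-cong-≋ (λ j → ≈-trans (*-congˡ (product-expand (u-pos j) w))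
             (*-distribˡ-∑ (indices n) (s j) _)) ⟩
      sumFin (λ j → ∑[ indices n ] λ I → s j * (ups I w * along (α (u j)) I))
        ≈⟨ sumFin-∑-comm {r} (indices n) (λ j I → s j * (ups I w * along (α (u j)) I)) ⟩
      ∑[ indices n ] (λ I → sumFin λ j → s j * (ups I w * along (α (u j)) I))
        ≈⟨ ∑-cong (indices n) (λ I → ≈-trans
             (sum-cong-≋ {r} λ j → solve 3 (λ s x y → s :* (x :* y) := x :* (s :* y)) ≈-refl
                (s j) (ups I w) (along (α (u j)) I))
             (≈-sym (*-distribˡ-sum {r} (ups I w) (λ j → s j * along (α (u j)) I)))) ⟩
      ∑[ indices n ] (λ I → ups I w * weight I) ∎

    european-lower : ∀ {n} (w : Vec 𝓛 n) →
                     ∑[ indices n ] (λ I → ups I w * (weight I - C) ⁺) ≤ european u s C w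
    european-lower {n} w = begin
      ∑[ indices n ] (λ I → ups I w * (weight I - C) ⁺)
        ≤⟨ ⁺-superadditive-∑ (indices n) (λ I → ups-0∨1 I w) weight-nonNeg 0≤C ⟩
      (∑[ indices n ] (λ I → ups I w * weight I) - C) ⁺
        ≈⟨ ⁺-cong (+-congʳ (payoff-expand w)) ⟨
      european u s C w ∎

    -- Both products depend on `I` only through its letter counts, so the sum over tuples with
    -- multinomial weights ungroups into a sum over index words.
    multinomialBound≈∑ : ∀ n b → multinomialBound n b u s C ≈
                         ∑[ indices n ] λ I → along (β b) I * (weight I - C) ⁺
    multinomialBound≈∑ n b = ≈-trans (≈-sym (∑-counts commutativeSemiring (suc m) n _))
      (∑-cong (indices n) λ I → *-cong (product-counts (β b) I)
        (⁺-cong (+-congʳ (sum-cong-≋ λ j → *-congˡ (product-counts (α (u j)) I)))))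

    multinomialBound≤𝔼 : ∀ {b n} (Φ : Strategy {b} n) →
                         multinomialBound n b u s C ≤ 𝔼 (pathDensity Φ) (european u s C)
    multinomialBound≤𝔼 {b} {n} Φ = begin
      multinomialBound n b u s C
        ≈⟨ multinomialBound≈∑ n b ⟩
      ∑[ indices n ] (λ I → along (β b) I * G I)
        ≈⟨ ∑-cong (indices n) (λ I → *-congʳ (𝔼-ups Φ I)) ⟨
      ∑[ indices n ] (λ I → 𝔼 Q (ups I) * G I)
        ≈⟨ ∑-cong (indices n) (λ I → ≈-trans (*-distribʳ-∑ (words all𝓛 n) (G I) _)
             (∑-cong (words all𝓛 n) λ w → *-assoc _ _ _)) ⟩
      ∑[ indices n ] (λ I → ∑[ words all𝓛 n ] λ w → Q w * (ups I w * G I))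
        ≈⟨ ∑-comm (indices n) (words all𝓛 n) _ ⟩
      ∑[ words all𝓛 n ] (λ w → ∑[ indices n ] λ I → Q w * (ups I w * G I))
        ≈⟨ ∑-cong (words all𝓛 n) (λ w → *-distribˡ-∑ (indices n) (Q w) _) ⟨
      𝔼 Q (λ w → ∑[ indices n ] λ I → ups I w * G I)
        ≤⟨ 𝔼-mono-≤ Φ european-lower ⟩
      𝔼 Q (european u s C) ∎
      where
      Q = pathDensity Φ
      G : Vec (Fin (suc m)) n → Carrier
      G I = (weight I - C) ⁺

theorem1p13 : ∀ {c ℓ₁ ℓ₂} (ℝ : CompleteOrderedField c ℓ₁ ℓ₂)
    (m n r : ℕ) .{{_ : NonZero m}} .{{_ : NonZero n}} →
    let open Model ℝ m in
    (b : Fin m → Carrier) → ∃ (P b) →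
    (u : Fin r → 𝓛 → Carrier) →
    (∀ j → ℓ-Positive (u j)) →
    (∀ j λ₁ → u j λ₁ ≈ (u j λ₁) ⁺) →
    (s : Fin r → Carrier) (C : Carrier) →
    (∀ j → 0# ≤ s j) → 0# ≤ C →
    ∃[ μ ] IsFmin (Γ n b) (european u s C) μ × multinomialBound n b u s C ≤ μ
theorem1p13 ℝ m n r b x₀ u u-pos u≈u⁺ s C 0≤s 0≤C =
  μ ,
  record
    { attained   = pathDensity Φ , (Φ , λ _ → ≈-refl) , ≈-refl
    -- A member of `Γ` agrees with a path density only up to pointwise `≈`, so the bound is
    -- transported along `Q≈`.
    ; lowerBound = λ { Q (Φ′ , Q≈) → ≤-trans (Φ-minimal Φ′)
        (≤-reflexive (∑-cong (words all𝓛 n) λ w → *-congʳ (≈-sym (Q≈ w)))) }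
    } ,
  multinomialBound≤𝔼 u u-pos u≈u⁺ s C 0≤s 0≤C Φ
  where
  open OrderedField ℝ m
  open Dynamic ℝ m
  open LowerBound ℝ m
  minimal : ∃[ Φ ] ∀ Φ′ → 𝔼 (pathDensity {b} Φ) (european u s C) ≤
                           𝔼 (pathDensity {b} Φ′) (european u s C)
  minimal = minimalStrategy x₀ (european u s C) (λ _ → 0≤x⁺ _)
  Φ = proj₁ minimal
  Φ-minimal = proj₂ minimal
  μ = 𝔼 (pathDensity Φ) (european u s C)
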